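{- Let $k$ be a non-negative integer and let $G$ be a graph of rank-width at most $k$ with $|V(G)|\geq 3$. Then there exists a graph $H$ having a pivot-minor isomorphic to $G$ such that the tree-width of $H$ is at most $2k$ and $|V(H)|\leq (2k+1)|V(G)|-6k$.
   Context: All graphs are finite, simple and undirected. For a graph $G$ and a vertex $v$, local complementation at $v$ produces the graph $G*v$ obtained from $G$ by replacing the edge set $E$ by $E\,\Delta\,\{xy: xv,yv\in E,\ x\neq y\}$. For an edge $uv$, pivoting $uv$ produces $G\wedge uv = G*u*v*u$. A graph $H'$ is a pivot-minor of $G$ if $H'$ can be obtained from $G$ by a sequence of vertex deletions and pivotings of edges. Let $A(G)$ denote the adjacency matrix of $G$ over the binary field; the cut-rank of $X\subseteq V(G)$ is the rank of the submatrix of $A(G)$ with rows $X$ and columns $V(G)\setminus X$. A tree is subcubic if it has at least two vertices and every vertex of degree other than $1$ has degree $3$. A rank-decomposition of $G$ is a pair $(T,L)$ with $T$ a subcubic tree and $L$ a bijection from $V(G)$ to the leaves of $T$; the width of an edge $e$ of $T$ is the cut-rank of $L^{ -1}(X_e)$, where $X_e$ is the set of leaves in one component of $T\setminus e$; the width of $(T,L)$ is the maximum width of its edges; the rank-width of $G$ is the minimum width of a rank-decomposition of $G$ (and is $0$ if $|V(G)|\le 1$). Tree-width is the usual notion. -}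

module Defs where

open import Data.Nat using (ℕ; zero; suc; _+_; _*_; _≤_)
open import Data.Fin using (Fin; zero; suc; punchIn; _≟_)
open import Data.Bool using (Bool; true; false; _∧_; _∨_; _xor_; not)
open import Data.Product using (Σ; ∃; _×_; _,_)
open import Data.Sum using (_⊎_)
open import Data.Unit using (⊤)
open import Relation.Nullary using (¬_; yes; no)
open import Relation.Nullary.Decidable using (⌊_⌋)
open import Relation.Binary.PropositionalEquality using (_≡_; refl; sym)
open import Function.Bundles using (_⤖_; Bijection)
open import Function.Definitions using (Injective)

record Graph (n : ℕ) : Set where
  field
    adj   : Fin n → Fin n → Bool
    adj-sym   : ∀ x y → adj x y ≡ adj y x
    adj-irrefl : ∀ x → adj x x ≡ false
open Graph public

_==_ : ∀ {n} → Fin n → Fin n → Bool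
x == y = ⌊ x ≟ y ⌋

private
  ==-sym : ∀ {n} (x y : Fin n) → (x == y) ≡ (y == x)
  ==-sym x y with x ≟ y | y ≟ x
  ... | yes _ | yes _ = refl
  ... | no _  | no _  = refl
  ... | yes p | no q  with q (sym p)
  ... | ()
  ==-sym x y | no q | yes p with q (sym p)
  ... | ()

  ==-refl : ∀ {n} (x : Fin n) → (x == x) ≡ true
  ==-refl x with x ≟ x
  ... | yes _ = refl
  ... | no q with q refl
  ... | ()

  ∧-comm : ∀ a b → (a ∧ b) ≡ (b ∧ a)
  ∧-comm false false = refl
  ∧-comm false true  = refl
  ∧-comm true  false = refl
  ∧-comm true  true  = refl

  ∧-false : ∀ a → (a ∧ false) ≡ false
  ∧-false false = refl
  ∧-false true  = refl

localComp : ∀ {n} → Graph n → Fin n → Graph n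
localComp {n} G v = record { adj = A ; adj-sym = S ; adj-irrefl = I }
  where
  A : Fin n → Fin n → Bool
  A x y = adj G x y xor ((adj G x v ∧ adj G y v) ∧ not (x == y))
  S : ∀ x y → A x y ≡ A y x
  S x y rewrite adj-sym G x y | ∧-comm (adj G x v) (adj G y v) | ==-sym x y = refl
  I : ∀ x → A x x ≡ false
  I x rewrite adj-irrefl G x | ==-refl x | ∧-false (adj G x v ∧ adj G x v) = refl

pivot : ∀ {n} → Graph n → Fin n → Fin n → Graph n
pivot G u v = localComp (localComp (localComp G u) v) u

deleteVertex : ∀ {n} → Graph (suc n) → Fin (suc n) → Graph n
deleteVertex G v = record
  { adj = λ x y → adj G (punchIn v x) (punchIn v y)
  ; adj-sym = λ x y → adj-sym G (punchIn v x) (punchIn v y)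
  ; adj-irrefl = λ x → adj-irrefl G (punchIn v x)
  }

data _≤pm_ : ∀ {m n} → Graph m → Graph n → Set where
  pm-refl  : ∀ {n} {G : Graph n} → G ≤pm G
  pm-del   : ∀ {m n} {H : Graph m} {G : Graph (suc n)} (v : Fin (suc n)) →
             H ≤pm deleteVertex G v → H ≤pm G
  pm-pivot : ∀ {m n} {H : Graph m} {G : Graph n} (u v : Fin n) →
             adj G u v ≡ true → H ≤pm pivot G u v → H ≤pm G

_≅_ : ∀ {m n} → Graph m → Graph n → Set
_≅_ {m} {n} G H = Σ (Fin m ⤖ Fin n) λ φ →
  ∀ x y → adj G x y ≡ adj H (Bijection.to φ x) (Bijection.to φ y)

countTrue : ∀ {n} → (Fin n → Bool) → ℕ
countTrue {zero}  f = 0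
countTrue {suc n} f with f zero
... | true  = suc (countTrue (λ i → f (suc i)))
... | false = countTrue (λ i → f (suc i))

xorSum : ∀ {n} → (Fin n → Bool) → Bool
xorSum {zero}  f = false
xorSum {suc n} f = f zero xor xorSum (λ i → f (suc i))

degree : ∀ {n} → Graph n → Fin n → ℕ
degree G v = countTrue (adj G v)

data Walk {t : ℕ} (A : Fin t → Fin t → Bool) (P : Fin t → Set) :
          Fin t → Fin t → Set where
  stop : ∀ {a} → P a → Walk A P a a
  step : ∀ {a b c} → P a → A a b ≡ true → Walk A P b c → Walk A P a c

Reach : ∀ {t} → (Fin t → Fin t → Bool) → Fin t → Fin t → Set
Reach A = Walk A (λ _ → ⊤)

removeEdge : ∀ {t} → (Fin t → Fin t → Bool) → Fin t → Fin t →
             Fin t → Fin t → Bool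
removeEdge A u v x y =
  A x y ∧ not (((x == u) ∧ (y == v)) ∨ ((x == v) ∧ (y == u)))

-- a tree: connected, and no cycle (no edge uv whose ends are still
-- joined after deleting uv); nonempty
IsTree : ∀ {t} → Graph t → Set
IsTree {t} T =
  1 ≤ t ×
  (∀ u v → Reach (adj T) u v) ×
  (∀ u v → adj T u v ≡ true → ¬ Reach (removeEdge (adj T) u v) u v)

-- cut-rank of X in G is at most k: every family of rows indexed by X
-- that is linearly independent over GF(2) in the submatrix
-- A(G)[X, V(G) \ X] has at most k members.
CutRankAtMost : ∀ {n} → Graph n → (Fin n → Set) → ℕ → Set
CutRankAtMost {n} G X k =
  ∀ (r : ℕ) (f : Fin r → Fin n) → (∀ i → X (f i)) →
  (∀ (a : Fin r → Bool) →
     (∀ (c : Fin n) → ¬ X c → xorSum (λ i → a i ∧ adj G (f i) c) ≡ false) →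
     ∀ i → a i ≡ false) →
  r ≤ k

record RankDecomposition {n : ℕ} (G : Graph n) (k : ℕ) : Set where
  field
    t        : ℕ
    T        : Graph t
    tree     : IsTree T
    twoNodes : 2 ≤ t
    subcubic : ∀ v → degree T v ≡ 1 ⊎ degree T v ≡ 3
    L        : Fin n → Fin t
    L-inj    : Injective _≡_ _≡_ L
    L-leaf   : ∀ x → degree T (L x) ≡ 1
    L-onto   : ∀ ℓ → degree T ℓ ≡ 1 → ∃ λ x → L x ≡ ℓ
    -- every edge uv of T: the leaf set of the component of T \ uv
    -- containing u has cut-rank ≤ k (both orientations are covered)
    width    : ∀ u v → adj T u v ≡ true →
               CutRankAtMost G (λ x → Reach (removeEdge (adj T) u v) u (L x)) k

RankWidthAtMost : ∀ {n} → Graph n → ℕ → Set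
RankWidthAtMost {n} G k = n ≤ 1 ⊎ RankDecomposition G k

record TreeDecomposition {m : ℕ} (H : Graph m) (w : ℕ) : Set where
  field
    t      : ℕ
    T      : Graph t
    tree   : IsTree T
    bag    : Fin t → Fin m → Bool
    covV   : ∀ x → ∃ λ a → bag a x ≡ true
    covE   : ∀ x y → adj H x y ≡ true → ∃ λ a → bag a x ≡ true × bag a y ≡ true
    connected : ∀ x a b → bag a x ≡ true → bag b x ≡ true →
                Walk (adj T) (λ c → bag c x ≡ true) a b
    -- width = max bag size - 1 ≤ w
    small  : ∀ a → countTrue (bag a) ≤ suc w

TreeWidthAtMost : ∀ {m} → Graph m → ℕ → Set
TreeWidthAtMost H w = TreeDecomposition H w

module Submission where

-- Root the decomposition tree at a leaf.  For every cut X | V∖X of the remaining binary tree choose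
-- a row basis U of A(G)[X , V∖X], taking the basis of a node inside the union of the bases of its two
-- children.  Split every internal edge of the tree: add a lower and an upper copy of each u ∈ U,
-- joined by an edge; the lower copies are joined to the bases of the children according to the
-- coordinates with respect to U, the upper copies inherit the adjacencies of U to the outside.
-- Pivoting the edge between the two copies of u and deleting both adds (coordinate of x at u)·A(u,y)
-- to every entry A(x,y) of the cut, so contracting all of U restores the cut of G.  In the expanded
-- graph the bases of two siblings form a bag of size at most 2k.  Because U lies inside this bag, its
-- elements can be exchanged one at a time for their lower copies, and these for the upper copies,
-- with one additional vertex per bag.  There are n − 3 internal edges, each contributing at most 2k
-- vertices.

-- `H` is not built first and reduced afterwards. It grows out of `G` one pair of copies at a time,
-- and each growth step is undone by one pivot and two deletions. The obstacle is that when a cut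
-- comes to be split, the graph on its two sides is no longer `G`. For this reason the surroundings
-- `Y` of a subtree are kept arbitrary, and only the linear relations among the rows of the subtree
-- are required to persist on `Y`. Parts expanded earlier respect this: seen from a disjoint
-- subtree, their columns are columns of `G` or zero.
--
-- Choosing each basis inside the children's bases is what permits the exchange within 2k + 1. The
-- lower copies of an arbitrary basis could each be adjacent to all 2k slots, so no slot could be
-- dropped before every lower copy had been added.
--
-- With one leaf as root, the other n - 1 leaves give n - 2 inner nodes. The topmost one is not
-- split, since its cut is that of the root leaf, and this leaves n - 3 splittings and the constant
-- 6k.

open import Defs
open import Data.Nat using (ℕ; zero; suc; _+_; _*_; _≤_; z≤n; s≤s)
open import Data.Nat.Properties
  using (suc-injective; m≤n⇒m≤1+n; m≤m+n; 1+n≰n; ≤-pred; ≤-refl; ≤-reflexive; ≤-trans;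
         +-mono-≤; +-monoˡ-≤; +-monoʳ-≤; *-monoˡ-≤; *-monoʳ-≤; module ≤-Reasoning)
open import Data.Nat.Tactic.RingSolver using (solve-∀)
open import Data.Fin using (Fin; zero; suc; punchIn; splitAt; join; _≟_)
open import Data.Fin.Properties using (all?; splitAt-join; join-splitAt; injective⇒≤)
open import Data.Fin.Subset.Properties using (anySubset?)
open import Data.Bool using (Bool; true; false; _∧_; _xor_; not)
import Data.Bool.Properties as Bool
open import Data.Bool.Properties using (xor-comm; xor-identityʳ; xor-same; ∧-comm; ∧-zeroʳ; ∧-identityʳ)
open import Data.List using (List; []; _∷_; length; map; tabulate; filter; allFin)
open import Data.List.Properties using (length-map; length-tabulate; filter-notAll)
open import Data.List.Membership.Propositional using (lose) renaming (_∈_ to _∈ˡ_)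
open import Data.List.Membership.Propositional.Properties
  using (∈-map⁺; ∈-map⁻; ∈-tabulate⁺; ∈-tabulate⁻; ∈-filter⁺; ∈-allFin)
open import Data.List.Membership.DecPropositional using () renaming (_∈?_ to member?)
open import Data.List.Relation.Unary.Any using (here; there)
open import Data.Vec as Vec using (lookup)
open import Data.Vec.Properties using (lookup∘tabulate)
open import Data.Vec.Functional using (updateAt)
open import Data.Vec.Functional.Properties using (updateAt-updates; updateAt-minimal)
open import Data.Product using (Σ; ∃; _×_; _,_; proj₁; proj₂)
open import Data.Sum as Sum using (_⊎_; inj₁; inj₂; [_,_]; map₂; assocʳ; assocˡ)
open import Data.Sum.Properties using (inj₁-injective; inj₂-injective)
open import Data.Unit using (⊤; tt)
open import Data.Empty using (⊥; ⊥-elim)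
open import Function using (_∘_; id)
open import Function.Construct.Identity using (⤖-id)
open import Relation.Nullary using (¬_; Dec; yes; no)
open import Relation.Nullary.Decidable using (map′; ⌊_⌋; ¬?; _⊎-dec_)
open import Relation.Binary.PropositionalEquality
  using (_≡_; _≢_; refl; sym; trans; cong; cong₂; subst; subst₂; module ≡-Reasoning)

-- Pivot-minors and expansions

_≈_ : ∀ {n} → Graph n → Graph n → Set
G ≈ H = ∀ x y → adj G x y ≡ adj H x y

localComp-cong : ∀ {n} {G H : Graph n} v → G ≈ H → localComp G v ≈ localComp H v
localComp-cong v e x y rewrite e x y | e x v | e y v = refl

pivot-cong : ∀ {n} {G H : Graph n} u v → G ≈ H → pivot G u v ≈ pivot H u v
pivot-cong {G = G} {H} u v e =
  localComp-cong {G = localComp (localComp G u) v} {localComp (localComp H u) v} u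
    (localComp-cong {G = localComp G u} {localComp H u} v (localComp-cong {G = G} {H} u e))

-- Undoing an expansion returns the old adjacency only pointwise, whereas `_≤pm_` ends at one
-- particular record; hence pivot-minors up to `≈`.
_≼_ : ∀ {n m} → Graph n → Graph m → Set
_≼_ {n} G H = Σ (Graph n) λ G′ → (G′ ≤pm H) × (G′ ≈ G)

≤pm-resp-≈ : ∀ {n m} {G : Graph n} {H H′ : Graph m} → G ≤pm H → H ≈ H′ → G ≼ H′
≤pm-resp-≈ {H′ = H′} pm-refl e = H′ , pm-refl , λ x y → sym (e x y)
≤pm-resp-≈ {H′ = H′} (pm-del v p) e =
  let G″ , q , f = ≤pm-resp-≈ {H′ = deleteVertex H′ v} p (λ x y → e (punchIn v x) (punchIn v y))
  in G″ , pm-del v q , f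
≤pm-resp-≈ {H = H} {H′} (pm-pivot u v uv p) e =
  let G″ , q , f = ≤pm-resp-≈ {H′ = pivot H′ u v} p (pivot-cong {G = H} {H′} u v e)
  in G″ , pm-pivot u v (trans (sym (e u v)) uv) q , f

≤pm-trans : ∀ {a b c} {F : Graph a} {G : Graph b} {H : Graph c} → F ≤pm G → G ≤pm H → F ≤pm H
≤pm-trans p pm-refl = p
≤pm-trans p (pm-del v q) = pm-del v (≤pm-trans p q)
≤pm-trans p (pm-pivot u v uv q) = pm-pivot u v uv (≤pm-trans p q)

≼-refl : ∀ {n} {G : Graph n} → G ≼ G
≼-refl {G = G} = G , pm-refl , λ _ _ → refl

≼-trans : ∀ {a b c} {F : Graph a} {G : Graph b} {H : Graph c} → F ≼ G → G ≼ H → F ≼ H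
≼-trans (F′ , p , e) (G′ , q , f) =
  let F″ , r , g = ≤pm-resp-≈ {H′ = G′} p (λ x y → sym (f x y))
  in F″ , ≤pm-trans r q , λ x y → trans (g x y) (e x y)

-- The vertices false and true are new and adjacent to each other, with P and Q as their
-- neighbourhoods in W.  The correction on W is the one undone by pivoting this edge.
expand : {W : Set} → (W → W → Bool) → (P Q : W → Bool) → Bool ⊎ W → Bool ⊎ W → Bool
expand A P Q (inj₁ a)     (inj₁ b)     = a xor b
expand A P Q (inj₁ false) (inj₂ y)     = P y
expand A P Q (inj₁ true)  (inj₂ y)     = Q y
expand A P Q (inj₂ x)     (inj₁ false) = P x
expand A P Q (inj₂ x)     (inj₁ true)  = Q x
expand A P Q (inj₂ x)     (inj₂ y)     = A x y xor ((P x ∧ Q y) xor (Q x ∧ P y))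

expand-sym : {W : Set} (A : W → W → Bool) (P Q : W → Bool) → (∀ x y → A x y ≡ A y x) →
  ∀ x y → expand A P Q x y ≡ expand A P Q y x
expand-sym A P Q s (inj₁ a)     (inj₁ b)     = xor-comm a b
expand-sym A P Q s (inj₁ false) (inj₂ y)     = refl
expand-sym A P Q s (inj₁ true)  (inj₂ y)     = refl
expand-sym A P Q s (inj₂ x)     (inj₁ false) = refl
expand-sym A P Q s (inj₂ x)     (inj₁ true)  = refl
expand-sym A P Q s (inj₂ x)     (inj₂ y)     =
  cong₂ _xor_ (s x y) (trans (xor-comm (P x ∧ Q y) (Q x ∧ P y))
                              (cong₂ _xor_ (∧-comm (Q x) (P y)) (∧-comm (P x) (Q y))))

expand-irrefl : {W : Set} (A : W → W → Bool) (P Q : W → Bool) → (∀ x → A x x ≡ false) →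
  ∀ x → expand A P Q x x ≡ false
expand-irrefl A P Q s (inj₁ a) = xor-same a
expand-irrefl A P Q s (inj₂ x) rewrite s x | ∧-comm (P x) (Q x) = xor-same (Q x ∧ P x)

split₂ : ∀ {m} → Fin (2 + m) → Bool ⊎ Fin m
split₂ zero          = inj₁ false
split₂ (suc zero)    = inj₁ true
split₂ (suc (suc x)) = inj₂ x

expandGraph : ∀ {m} → Graph m → (P Q : Fin m → Bool) → Graph (2 + m)
expandGraph H P Q = record
  { adj        = λ x y → expand (adj H) P Q (split₂ x) (split₂ y)
  ; adj-sym    = λ x y → expand-sym (adj H) P Q (adj-sym H) (split₂ x) (split₂ y)
  ; adj-irrefl = λ x → expand-irrefl (adj H) P Q (adj-irrefl H) (split₂ x)
  }

suc-==-suc : ∀ {n} (i j : Fin n) → (suc i == suc j) ≡ (i == j)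
suc-==-suc i j with i ≟ j
... | yes _ = refl
... | no _  = refl

BoolFun : ℕ → Set
BoolFun zero    = Bool
BoolFun (suc n) = Bool → BoolFun n

Agree : ∀ n → BoolFun n → BoolFun n → Set
Agree zero    a b = a ≡ b
Agree (suc n) f g = ∀ x → Agree n (f x) (g x)

agree? : ∀ n → BoolFun n → BoolFun n → Bool
agree? zero    a b = not (a xor b)
agree? (suc n) f g = agree? n (f false) (g false) ∧ agree? n (f true) (g true)

-- Proof by evaluation: for concrete `f` and `g` the premise is a closed Boolean that runs through
-- all assignments, so callers pass `refl`.
truthTable : ∀ n (f g : BoolFun n) → agree? n f g ≡ true → Agree n f g
truthTable zero    false false p = refl
truthTable zero    true  true  p = refl
truthTable (suc n) f g p x with agree? n (f false) (g false) in p₀ | agree? n (f true) (g true) in p₁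
truthTable (suc n) f g p false | true | true = truthTable n (f false) (g false) p₀
truthTable (suc n) f g p true  | true | true = truthTable n (f true) (g true) p₁

-- Pivoting an edge toggles a pair of other vertices exactly when they lie in different classes
-- among the neighbours of one end only, of the other end only, and of both. Over GF(2) this is the
-- determinant of `(P x , Q x)` and `(P y , Q y)`, which is the correction that `expand` has put in.
≼-expandGraph : ∀ {m} (H : Graph m) (P Q : Fin m → Bool) → H ≼ expandGraph H P Q
≼-expandGraph {m} H P Q =
  deleteVertex (deleteVertex (pivot E zero (suc zero)) zero) zero ,
  pm-pivot zero (suc zero) refl (pm-del zero (pm-del zero pm-refl)) , eq
  where
  E : Graph (2 + m)
  E = expandGraph H P Q
  eq : deleteVertex (deleteVertex (pivot E zero (suc zero)) zero) zero ≈ H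
  -- The diagonal is separate because local complementation masks it. The lambdas spell out the
  -- three local complementations; `entry` is the adjacency of an old vertex to `zero` after two of
  -- them.
  eq x y with x ≟ y
  ... | no _ = truthTable 5
    (λ h p q p′ q′ →
      let entry = λ p q → (p xor (p ∧ false) ∧ true) xor ((q xor (p ∧ true) ∧ true) ∧ true) ∧ true
      in (((h xor p ∧ q′ xor q ∧ p′) xor (p ∧ p′) ∧ true) xor
           ((q xor (p ∧ true) ∧ true) ∧ (q′ xor (p′ ∧ true) ∧ true)) ∧ true) xor
         (entry p q ∧ entry p′ q′) ∧ true)
    (λ h _ _ _ _ → h) refl (adj H x y) (P x) (Q x) (P y) (Q y)
  ... | yes refl = truthTable 3
    (λ h p q →
      let entry = (p xor (p ∧ false) ∧ true) xor ((q xor (p ∧ true) ∧ true) ∧ true) ∧ true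
      in (((h xor p ∧ q xor q ∧ p) xor (p ∧ p) ∧ false) xor
           ((q xor (p ∧ true) ∧ true) ∧ (q xor (p ∧ true) ∧ true)) ∧ false) xor
         (entry ∧ entry) ∧ false)
    (λ h _ _ → h) refl (adj H x x) (P x) (Q x)

-- Lets the role of a vertex (upper copy, lower copy, surroundings) be read off its type `W`,
-- although pivot-minors are defined for graphs on `Fin m`.
record Realisation {n : ℕ} (G : Graph n) {W : Set} (A : W → W → Bool) (m : ℕ) : Set where
  field
    graph   : Graph m
    minor   : G ≼ graph
    vertex  : Fin m → W
    index   : W → Fin m
    vertex∘index : ∀ w → vertex (index w) ≡ w
    index∘vertex : ∀ i → index (vertex i) ≡ i
    adj-vertex   : ∀ i j → adj graph i j ≡ A (vertex i) (vertex j)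
open Realisation public

-- The first summand holds the upper copies (neighbourhoods Q), the second the lower ones (P).
expandAll : {W : Set} {q : ℕ} → (W → W → Bool) → (P Q : Fin q → W → Bool) →
  Fin q ⊎ Fin q ⊎ W → Fin q ⊎ Fin q ⊎ W → Bool
expandAll A P Q (inj₁ i)        (inj₁ j)        = false
expandAll A P Q (inj₁ i)        (inj₂ (inj₁ j)) = i == j
expandAll A P Q (inj₁ i)        (inj₂ (inj₂ y)) = Q i y
expandAll A P Q (inj₂ (inj₁ i)) (inj₁ j)        = i == j
expandAll A P Q (inj₂ (inj₁ i)) (inj₂ (inj₁ j)) = false
expandAll A P Q (inj₂ (inj₁ i)) (inj₂ (inj₂ y)) = P i y
expandAll A P Q (inj₂ (inj₂ x)) (inj₁ j)        = Q j x
expandAll A P Q (inj₂ (inj₂ x)) (inj₂ (inj₁ j)) = P j x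
expandAll A P Q (inj₂ (inj₂ x)) (inj₂ (inj₂ y)) =
  A x y xor xorSum (λ i → (P i x ∧ Q i y) xor (Q i x ∧ P i y))

onRest : {q : ℕ} {W : Set} → (W → Bool) → Fin q ⊎ Fin q ⊎ W → Bool
onRest P (inj₁ _)        = false
onRest P (inj₂ (inj₁ _)) = false
onRest P (inj₂ (inj₂ x)) = P x

module _ {n : ℕ} {G : Graph n} where

  relabel : {W W′ : Set} {A : W → W → Bool} {B : W′ → W′ → Bool} {m : ℕ}
    (f : W → W′) (g : W′ → W) → (∀ w → f (g w) ≡ w) → (∀ w → g (f w) ≡ w) →
    (∀ x y → A x y ≡ B (f x) (f y)) → Realisation G A m → Realisation G B m
  relabel f g fg gf e R = record
    { graph = graph R
    ; minor = minor R
    ; vertex = f ∘ vertex R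
    ; index = index R ∘ g
    ; vertex∘index = λ w → trans (cong f (vertex∘index R (g w))) (fg w)
    ; index∘vertex = λ i → trans (cong (index R) (gf (vertex R i))) (index∘vertex R i)
    ; adj-vertex = λ i j → trans (adj-vertex R i j) (e (vertex R i) (vertex R j))
    }

  realise-expand : {W : Set} {A : W → W → Bool} {m : ℕ} (P Q : W → Bool) →
    Realisation G A m → Realisation G (expand A P Q) (2 + m)
  realise-expand {W} {A} {m} P Q R = record
    { graph = E
    ; minor = ≼-trans {F = G} {G = graph R} {H = E} (minor R)
        (≼-expandGraph (graph R) (P ∘ vertex R) (Q ∘ vertex R))
    ; vertex = v
    ; index = w
    ; vertex∘index = λ { (inj₁ false) → refl ; (inj₁ true) → refl
                       ; (inj₂ x) → cong inj₂ (vertex∘index R x) }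
    ; index∘vertex = λ { zero → refl ; (suc zero) → refl
                       ; (suc (suc i)) → cong (λ j → suc (suc j)) (index∘vertex R i) }
    ; adj-vertex = e
    }
    where
    E : Graph (2 + m)
    E = expandGraph (graph R) (P ∘ vertex R) (Q ∘ vertex R)
    v : Fin (2 + m) → Bool ⊎ W
    v i = map₂ (vertex R) (split₂ i)
    w : Bool ⊎ W → Fin (2 + m)
    w (inj₁ false) = zero
    w (inj₁ true)  = suc zero
    w (inj₂ x)     = suc (suc (index R x))
    e : ∀ i j → adj E i j ≡ expand A P Q (v i) (v j)
    e i j with split₂ i | split₂ j
    ... | inj₁ a     | inj₁ b     = refl
    ... | inj₁ false | inj₂ y     = refl
    ... | inj₁ true  | inj₂ y     = refl
    ... | inj₂ x     | inj₁ false = refl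
    ... | inj₂ x     | inj₁ true  = refl
    ... | inj₂ x     | inj₂ y     = cong (_xor _) (adj-vertex R x y)

  -- The pairs do not interfere: a new pair has no neighbours among the earlier copies, so its
  -- correction vanishes there and the corrections on `W` simply add up.
  realise-expandAll : {W : Set} {A : W → W → Bool} {m : ℕ} (q : ℕ) (P Q : Fin q → W → Bool) →
    Realisation G A m → Realisation G (expandAll A P Q) (q * 2 + m)
  realise-expandAll {A = A} zero P Q R =
    relabel (inj₂ ∘ inj₂) (λ { (inj₂ (inj₂ x)) → x }) (λ { (inj₂ (inj₂ x)) → refl }) (λ _ → refl)
      (λ x y → sym (xor-identityʳ (A x y))) R
  realise-expandAll {W} {A} (suc q) P Q R =
    relabel f g fg gf e
      (realise-expand (onRest (P zero)) (onRest (Q zero))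
        (realise-expandAll q (P ∘ suc) (Q ∘ suc) R))
    where
    f : Bool ⊎ Fin q ⊎ Fin q ⊎ W → Fin (suc q) ⊎ Fin (suc q) ⊎ W
    f (inj₁ false)           = inj₂ (inj₁ zero)
    f (inj₁ true)            = inj₁ zero
    f (inj₂ (inj₁ i))        = inj₁ (suc i)
    f (inj₂ (inj₂ (inj₁ i))) = inj₂ (inj₁ (suc i))
    f (inj₂ (inj₂ (inj₂ x))) = inj₂ (inj₂ x)
    g : Fin (suc q) ⊎ Fin (suc q) ⊎ W → Bool ⊎ Fin q ⊎ Fin q ⊎ W
    g (inj₁ zero)           = inj₁ true
    g (inj₁ (suc i))        = inj₂ (inj₁ i)
    g (inj₂ (inj₁ zero))    = inj₁ false
    g (inj₂ (inj₁ (suc i))) = inj₂ (inj₂ (inj₁ i))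
    g (inj₂ (inj₂ x))       = inj₂ (inj₂ (inj₂ x))
    fg : ∀ w → f (g w) ≡ w
    fg (inj₁ zero)           = refl
    fg (inj₁ (suc i))        = refl
    fg (inj₂ (inj₁ zero))    = refl
    fg (inj₂ (inj₁ (suc i))) = refl
    fg (inj₂ (inj₂ x))       = refl
    gf : ∀ w → g (f w) ≡ w
    gf (inj₁ false)           = refl
    gf (inj₁ true)            = refl
    gf (inj₂ (inj₁ i))        = refl
    gf (inj₂ (inj₂ (inj₁ i))) = refl
    gf (inj₂ (inj₂ (inj₂ x))) = refl
    e : ∀ x y → expand (expandAll A (P ∘ suc) (Q ∘ suc)) (onRest (P zero)) (onRest (Q zero)) x y ≡
                expandAll A P Q (f x) (f y)
    e (inj₁ false) (inj₁ false) = refl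
    e (inj₁ false) (inj₁ true)  = refl
    e (inj₁ true)  (inj₁ false) = refl
    e (inj₁ true)  (inj₁ true)  = refl
    e (inj₁ false) (inj₂ (inj₁ i))        = refl
    e (inj₁ false) (inj₂ (inj₂ (inj₁ i))) = refl
    e (inj₁ false) (inj₂ (inj₂ (inj₂ x))) = refl
    e (inj₁ true)  (inj₂ (inj₁ i))        = refl
    e (inj₁ true)  (inj₂ (inj₂ (inj₁ i))) = refl
    e (inj₁ true)  (inj₂ (inj₂ (inj₂ x))) = refl
    e (inj₂ (inj₁ i))        (inj₁ false) = refl
    e (inj₂ (inj₂ (inj₁ i))) (inj₁ false) = refl
    e (inj₂ (inj₂ (inj₂ x))) (inj₁ false) = refl
    e (inj₂ (inj₁ i))        (inj₁ true)  = refl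
    e (inj₂ (inj₂ (inj₁ i))) (inj₁ true)  = refl
    e (inj₂ (inj₂ (inj₂ x))) (inj₁ true)  = refl
    e (inj₂ (inj₁ i))        (inj₂ (inj₁ j))        = refl
    e (inj₂ (inj₁ i))        (inj₂ (inj₂ (inj₁ j))) = trans (xor-identityʳ _) (sym (suc-==-suc i j))
    e (inj₂ (inj₁ i))        (inj₂ (inj₂ (inj₂ y))) = xor-identityʳ _
    e (inj₂ (inj₂ (inj₁ i))) (inj₂ (inj₁ j))        = trans (xor-identityʳ _) (sym (suc-==-suc i j))
    e (inj₂ (inj₂ (inj₁ i))) (inj₂ (inj₂ (inj₁ j))) = refl
    e (inj₂ (inj₂ (inj₁ i))) (inj₂ (inj₂ (inj₂ y))) = xor-identityʳ _
    e (inj₂ (inj₂ (inj₂ x))) (inj₂ (inj₁ j))        =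
      truthTable 3 (λ b p q → b xor (p ∧ false xor q ∧ false)) (λ b _ _ → b) refl _ (P zero x) (Q zero x)
    e (inj₂ (inj₂ (inj₂ x))) (inj₂ (inj₂ (inj₁ j))) =
      truthTable 3 (λ b p q → b xor (p ∧ false xor q ∧ false)) (λ b _ _ → b) refl _ (P zero x) (Q zero x)
    e (inj₂ (inj₂ (inj₂ x))) (inj₂ (inj₂ (inj₂ y))) =
      truthTable 3 (λ a b c → (a xor b) xor c) (λ a b c → a xor (c xor b)) refl (A x y) _ _

-- Bases of rows over GF(2)

xorSum-cong : ∀ {n} {f g : Fin n → Bool} → (∀ i → f i ≡ g i) → xorSum f ≡ xorSum g
xorSum-cong {zero}  e = refl
xorSum-cong {suc n} e = cong₂ _xor_ (e zero) (xorSum-cong (e ∘ suc))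

xorSum-false : ∀ {n} {f : Fin n → Bool} → (∀ i → f i ≡ false) → xorSum f ≡ false
xorSum-false {zero}  e = refl
xorSum-false {suc n} e rewrite e zero = xorSum-false (e ∘ suc)

xorSum-== : ∀ {n} (j : Fin n) (f : Fin n → Bool) → xorSum (λ i → (j == i) ∧ f i) ≡ f j
xorSum-== {suc n} zero f = trans (cong (f zero xor_) (xorSum-false {n} (λ _ → refl))) (xor-identityʳ (f zero))
xorSum-== (suc j) f = trans (xorSum-cong (λ i → cong (_∧ f (suc i)) (suc-==-suc j i))) (xorSum-== j (f ∘ suc))

-- `coord-sel` matters for the tree-decomposition: among the selected rows, only the `i`-th has a
-- nonzero coordinate at `i`, so each lower copy is adjacent to just the one selected slot that it
-- replaces.
record Basis {N n : ℕ} (M : Fin N → Fin n → Bool) : Set where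
  field
    rank  : ℕ
    sel   : Fin rank → Fin N
    coord : Fin N → Fin rank → Bool
    coord-sel : ∀ i j → coord (sel i) j ≡ (i == j)
    spanning  : ∀ z c → M z c ≡ xorSum (λ i → coord z i ∧ M (sel i) c)
    independent : ∀ (a : Fin rank → Bool) → (∀ c → xorSum (λ i → a i ∧ M (sel i) c) ≡ false) → ∀ i → a i ≡ false

inSpan? : ∀ {r n} (M : Fin r → Fin n → Bool) (v : Fin n → Bool) →
  Dec (∃ λ (a : Fin r → Bool) → ∀ c → v c ≡ xorSum (λ i → a i ∧ M i c))
inSpan? M v = map′
  (λ (s , e) → lookup s , e)
  (λ (a , e) → Vec.tabulate a , λ c → trans (e c) (xorSum-cong λ i → cong (_∧ M i c) (sym (lookup∘tabulate a i))))
  (anySubset? λ s → all? λ c → v c Bool.≟ xorSum (λ i → lookup s i ∧ M i c))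

basis : ∀ {N n} (M : Fin N → Fin n → Bool) → Basis M
basis {zero} M = record
  { rank = 0 ; sel = λ () ; coord = λ () ; coord-sel = λ ()
  ; spanning = λ () ; independent = λ _ _ () }
basis {suc N} M = extend (inSpan? (M ∘ suc ∘ Basis.sel B) (M zero))
  where
  B : Basis (M ∘ suc)
  B = basis (M ∘ suc)
  open Basis B
  extend : Dec _ → Basis M
  extend (yes (a , e)) = record
    { rank = rank
    ; sel = suc ∘ sel
    ; coord = λ { zero → a ; (suc z) → coord z }
    ; coord-sel = coord-sel
    ; spanning = λ { zero → e ; (suc z) → spanning z }
    ; independent = independent
    }
  extend (no ¬e) = record
    { rank = suc rank
    ; sel = λ { zero → zero ; (suc i) → suc (sel i) }
    ; coord = λ { zero zero → true ; zero (suc _) → false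
                ; (suc _) zero → false ; (suc z) (suc j) → coord z j }
    ; coord-sel = λ { zero zero → refl ; zero (suc j) → refl ; (suc i) zero → refl
                    ; (suc i) (suc j) → trans (coord-sel i j) (sym (suc-==-suc i j)) }
    ; spanning = λ { zero c → sym (trans (cong (M zero c xor_) (xorSum-false {rank} (λ _ → refl))) (xor-identityʳ _))
                   ; (suc z) c → spanning z c }
    ; independent = indep
    }
    where
    indep : ∀ (a : Fin (suc rank) → Bool) →
      (∀ c → (a zero ∧ M zero c) xor xorSum (λ i → a (suc i) ∧ M (suc (sel i)) c) ≡ false) →
      ∀ i → a i ≡ false
    indep a e with a zero in a₀
    -- A nonzero coefficient over GF(2) is 1, so the relation would express row zero through the
    -- others.
    ... | true  = ⊥-elim (¬e (a ∘ suc , λ c → sumZero _ _ (e c)))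
      where
      sumZero : ∀ x y → x xor y ≡ false → x ≡ y
      sumZero false y p = sym p
      sumZero true true p = refl
    ... | false = λ { zero → a₀ ; (suc i) → independent (a ∘ suc) e i }

-- The expansion of a graph along a binary tree

data BinTree (n : ℕ) : Set where
  leaf : Fin n → BinTree n
  node : BinTree n → BinTree n → BinTree n

Leaf : ∀ {n} → BinTree n → Set
Leaf (leaf x)   = ⊤
Leaf (node l r) = Leaf l ⊎ Leaf r

label : ∀ {n} (B : BinTree n) → Leaf B → Fin n
label (leaf x)   tt       = x
label (node l r) (inj₁ i) = label l i
label (node l r) (inj₂ i) = label r i

data _∈_ {n} (x : Fin n) : BinTree n → Set where
  here  : x ∈ leaf x
  left  : ∀ {l r} → x ∈ l → x ∈ node l r
  right : ∀ {l r} → x ∈ r → x ∈ node l r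

_∈?_ : ∀ {n} (x : Fin n) (B : BinTree n) → Dec (x ∈ B)
x ∈? leaf y   = map′ (λ { refl → here }) (λ { here → refl }) (x ≟ y)
x ∈? node l r = map′ [ left , right ] (λ { (left p) → inj₁ p ; (right p) → inj₂ p })
                     ((x ∈? l) ⊎-dec (x ∈? r))

label-∈ : ∀ {n} (B : BinTree n) (i : Leaf B) → label B i ∈ B
label-∈ (leaf x)   tt       = here
label-∈ (node l r) (inj₁ i) = left (label-∈ l i)
label-∈ (node l r) (inj₂ i) = right (label-∈ r i)

Disjoint : ∀ {n} → BinTree n → Set
Disjoint (leaf x)   = ⊤
Disjoint (node l r) = (∀ {x} → x ∈ l → ¬ x ∈ r) × Disjoint l × Disjoint r

attach : {X Y : Set} → (X → X → Bool) → (X → Y → Bool) → (Y → Y → Bool) → X ⊎ Y → X ⊎ Y → Bool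
attach A C D (inj₁ x) (inj₁ x′) = A x x′
attach A C D (inj₁ x) (inj₂ y)  = C x y
attach A C D (inj₂ y) (inj₁ x)  = C x y
attach A C D (inj₂ y) (inj₂ y′) = D y y′

module Expansion {n : ℕ} (G : Graph n) where

  rk        : BinTree n → ℕ
  -- The chosen basis of the rows of B has size rk B and consists of the vertices lab B i.  A leaf
  -- is always its own basis, even if its row vanishes; hence the separate treatment of k = 0.
  lab       : ∀ B → Fin (rk B) → Fin n
  topLab    : ∀ l r → Fin (rk l) ⊎ Fin (rk r) → Fin n
  -- Columns inside the subtree are set to zero in place of being deleted. Relations and rank stay
  -- the same, and every matrix has column set `Fin n`.
  cutRows   : ∀ l r → Fin (rk l + rk r) → Fin n → Bool
  nodeBasis : ∀ l r → Basis (cutRows l r)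
  select    : ∀ l r → Fin (rk (node l r)) → Fin (rk l) ⊎ Fin (rk r)

  rk (leaf x)   = 1
  rk (node l r) = Basis.rank (nodeBasis l r)
  lab (leaf x)   _ = x
  lab (node l r) i = topLab l r (select l r i)
  topLab l r = [ lab l , lab r ]
  cutRows l r z c = adj G (topLab l r (splitAt (rk l) z)) c ∧ not ⌊ c ∈? node l r ⌋
  nodeBasis l r = basis (cutRows l r)
  select l r i = splitAt (rk l) (Basis.sel (nodeBasis l r) i)

  coordinate : ∀ l r → Fin (rk l) ⊎ Fin (rk r) → Fin (rk (node l r)) → Bool
  coordinate l r z = Basis.coord (nodeBasis l r) (join (rk l) (rk r) z)

  cutRows-outside : ∀ l r z {c} → ¬ c ∈ node l r → cutRows l r z c ≡ adj G (topLab l r (splitAt (rk l) z)) c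
  cutRows-outside l r z {c} c∉ with c ∈? node l r
  ... | yes c∈ = ⊥-elim (c∉ c∈)
  ... | no _   = ∧-identityʳ _

  cutRows-inside : ∀ l r z {c} → c ∈ node l r → cutRows l r z c ≡ false
  cutRows-inside l r z {c} c∈ with c ∈? node l r
  ... | yes _ = ∧-zeroʳ _
  ... | no c∉ = ⊥-elim (c∉ c∈)

  coordinate-spanning : ∀ l r z {c} → ¬ c ∈ node l r →
    adj G (topLab l r z) c ≡ xorSum (λ i → coordinate l r z i ∧ adj G (lab (node l r) i) c)
  coordinate-spanning l r z {c} c∉ = begin
    adj G (topLab l r z) c
      ≡⟨ cong (λ w → adj G (topLab l r w) c) (sym (splitAt-join (rk l) (rk r) z)) ⟩
    adj G (topLab l r (splitAt (rk l) z′)) c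
      ≡⟨ sym (cutRows-outside l r z′ c∉) ⟩
    cutRows l r z′ c
      ≡⟨ Basis.spanning (nodeBasis l r) z′ c ⟩
    xorSum (λ i → coordinate l r z i ∧ cutRows l r (Basis.sel (nodeBasis l r) i) c)
      ≡⟨ xorSum-cong (λ i → cong (coordinate l r z i ∧_) (cutRows-outside l r _ c∉)) ⟩
    xorSum (λ i → coordinate l r z i ∧ adj G (lab (node l r) i) c) ∎
    where
    open ≡-Reasoning
    z′ = join (rk l) (rk r) z

  lab-∈ : ∀ B i → lab B i ∈ B
  topLab-∈ : ∀ l r z → topLab l r z ∈ node l r
  lab-∈ (leaf x)   _ = here
  lab-∈ (node l r) i = topLab-∈ l r (select l r i)
  topLab-∈ l r (inj₁ a) = left (lab-∈ l a)
  topLab-∈ l r (inj₂ b) = right (lab-∈ r b)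

  -- Upper copies of the basis of B first; inside Inner, the lower copies precede the vertices
  -- contributed by the children.  A leaf is a single vertex and counts as upper.
  Inner : BinTree n → Set
  V     : BinTree n → Set
  Inner (leaf x)   = ⊥
  Inner (node l r) = Fin (rk (node l r)) ⊎ V l ⊎ V r
  V B = Fin (rk B) ⊎ Inner B

  onTop : ∀ B → (Fin (rk B) → Bool) → V B → Bool
  onTop B f (inj₁ a) = f a
  onTop B f (inj₂ _) = false

  onTop-cong : ∀ B {f g : Fin (rk B) → Bool} → (∀ a → f a ≡ g a) → ∀ v → onTop B f v ≡ onTop B g v
  onTop-cong B e (inj₁ a) = e a
  onTop-cong B e (inj₂ _) = refl

  onTops : ∀ l r → (Fin (rk l) ⊎ Fin (rk r) → Bool) → V l ⊎ V r → Bool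
  onTops l r f = [ onTop l (f ∘ inj₁) , onTop r (f ∘ inj₂) ]

  -- A subtree meets the rest of the graph only in its upper copies, which carry the adjacencies in
  -- `G` of their labels. Both the induction over the tree and the bags rest on this locality.
  expansion : ∀ B → V B → V B → Bool
  joined    : ∀ l r → V l ⊎ V r → V l ⊎ V r → Bool
  expansion (leaf x)   _ _ = false
  expansion (node l r) (inj₁ i)        (inj₁ j)        = false
  expansion (node l r) (inj₁ i)        (inj₂ (inj₁ j)) = i == j
  expansion (node l r) (inj₁ i)        (inj₂ (inj₂ w)) = false
  expansion (node l r) (inj₂ (inj₁ i)) (inj₁ j)        = i == j
  expansion (node l r) (inj₂ (inj₁ i)) (inj₂ (inj₁ j)) = false
  expansion (node l r) (inj₂ (inj₁ i)) (inj₂ (inj₂ w)) = onTops l r (λ z → coordinate l r z i) w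
  expansion (node l r) (inj₂ (inj₂ w)) (inj₁ j)        = false
  expansion (node l r) (inj₂ (inj₂ w)) (inj₂ (inj₁ j)) = onTops l r (λ z → coordinate l r z j) w
  expansion (node l r) (inj₂ (inj₂ w)) (inj₂ (inj₂ u)) = joined l r w u
  joined l r = attach (expansion l)
    (λ v w → onTop r (λ b → onTop l (λ a → adj G (lab r b) (lab l a)) v) w) (expansion r)

  module _ {Y : Set} (F : Fin n → Y → Bool) (D : Y → Y → Bool) where

    -- Three stages within the same surroundings `Y`: the subtree untouched, the subtree expanded,
    -- and (`expanded₂`) both children expanded while the cut of the node itself is still unsplit.
    original : ∀ B → Leaf B ⊎ Y → Leaf B ⊎ Y → Bool
    original B = attach (λ x x′ → adj G (label B x) (label B x′)) (λ x → F (label B x)) D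

    expanded : ∀ B → V B ⊎ Y → V B ⊎ Y → Bool
    expanded B = attach (expansion B) (λ v y → onTop B (λ a → F (lab B a) y) v) D

    expanded₂ : ∀ l r → (V l ⊎ V r) ⊎ Y → (V l ⊎ V r) ⊎ Y → Bool
    expanded₂ l r = attach (joined l r) (λ w y → onTops l r (λ z → F (topLab l r z) y) w) D

  -- All that is needed of the columns indexed by Y: the linear relations between the rows of B that
  -- hold on the complement of B hold on Y as well.
  ColumnsOutside : {Y : Set} → BinTree n → (Fin n → Y → Bool) → Set
  ColumnsOutside {Y} B F = ∀ (y : Y) →
    (∃ λ c → ¬ c ∈ B × (∀ u → F u y ≡ adj G u c)) ⊎ (∀ u → F u y ≡ false)

  -- Number of vertices after expanding B inside a graph with m vertices.
  expandedOrder : BinTree n → ℕ → ℕ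
  expandedOrder (leaf x)   m = m
  expandedOrder (node l r) m = rk (node l r) * 2 + expandedOrder r (expandedOrder l m)

  -- Works bottom-up. Once the children are expanded, the cut to `Y` is carried by their upper
  -- copies, whose rows on `Y` are combinations of the basis rows of the node. Expanding with
  -- coordinates as `P` and basis rows as `Q` therefore cancels this cut.
  realise : ∀ {Y : Set} (F : Fin n → Y → Bool) (D : Y → Y → Bool) B {m} →
    ColumnsOutside B F → Disjoint B →
    Realisation G (original F D B) m → Realisation G (expanded F D B) (expandedOrder B m)
  -- `l` is expanded with `r` and `Y` as surroundings, then `r` with the expanded `l` and `Y`. Seen
  -- from `r`, the vertices of the expanded `l` have the columns of basis vertices, which lie
  -- outside `r` by disjointness, or zero columns; hence the two cases of `ColumnsOutside`.
  realise₂ : ∀ {Y : Set} (F : Fin n → Y → Bool) (D : Y → Y → Bool) l r {m} →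
    ColumnsOutside (node l r) F → Disjoint (node l r) →
    Realisation G (original F D (node l r)) m →
    Realisation G (expanded₂ F D l r) (expandedOrder r (expandedOrder l m))

  realise F D (leaf x) out disj =
    relabel (λ { (inj₁ tt) → inj₁ (inj₁ zero) ; (inj₂ y) → inj₂ y })
            (λ { (inj₁ _) → inj₁ tt ; (inj₂ y) → inj₂ y })
            (λ { (inj₁ (inj₁ zero)) → refl ; (inj₂ y) → refl })
            (λ { (inj₁ tt) → refl ; (inj₂ y) → refl })
            (λ { (inj₁ tt) (inj₁ tt) → adj-irrefl G x ; (inj₁ tt) (inj₂ y) → refl
               ; (inj₂ y) (inj₁ tt) → refl ; (inj₂ y) (inj₂ y′) → refl })
  realise {Y} F D B@(node l r) out disj R =
    relabel f g fg gf e (realise-expandAll (rk B) P Q (realise₂ F D l r out disj R))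
    where
    P Q : Fin (rk B) → (V l ⊎ V r) ⊎ Y → Bool
    P i (inj₁ w) = onTops l r (λ z → coordinate l r z i) w
    P i (inj₂ y) = false
    Q i (inj₁ w) = false
    Q i (inj₂ y) = F (lab B i) y
    f : Fin (rk B) ⊎ Fin (rk B) ⊎ (V l ⊎ V r) ⊎ Y → V B ⊎ Y
    f (inj₁ i)               = inj₁ (inj₁ i)
    f (inj₂ (inj₁ i))        = inj₁ (inj₂ (inj₁ i))
    f (inj₂ (inj₂ (inj₁ w))) = inj₁ (inj₂ (inj₂ w))
    f (inj₂ (inj₂ (inj₂ y))) = inj₂ y
    g : V B ⊎ Y → Fin (rk B) ⊎ Fin (rk B) ⊎ (V l ⊎ V r) ⊎ Y
    g (inj₁ (inj₁ i))        = inj₁ i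
    g (inj₁ (inj₂ (inj₁ i))) = inj₂ (inj₁ i)
    g (inj₁ (inj₂ (inj₂ w))) = inj₂ (inj₂ (inj₁ w))
    g (inj₂ y)               = inj₂ (inj₂ (inj₂ y))
    fg : ∀ w → f (g w) ≡ w
    fg (inj₁ (inj₁ i))        = refl
    fg (inj₁ (inj₂ (inj₁ i))) = refl
    fg (inj₁ (inj₂ (inj₂ w))) = refl
    fg (inj₂ y)               = refl
    gf : ∀ w → g (f w) ≡ w
    gf (inj₁ i)               = refl
    gf (inj₂ (inj₁ i))        = refl
    gf (inj₂ (inj₂ (inj₁ w))) = refl
    gf (inj₂ (inj₂ (inj₂ y))) = refl

    row : ∀ z y → F (topLab l r z) y ≡ xorSum (λ i → coordinate l r z i ∧ F (lab B i) y)
    row z y with out y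
    ... | inj₁ (c , c∉ , e) = trans (e _) (trans (coordinate-spanning l r z c∉)
            (xorSum-cong λ i → cong (coordinate l r z i ∧_) (sym (e _))))
    ... | inj₂ e = trans (e _) (sym (xorSum-false {rk B} λ i →
            trans (cong (coordinate l r z i ∧_) (e _)) (∧-zeroʳ (coordinate l r z i))))

    rows : ∀ w y → onTops l r (λ z → F (topLab l r z) y) w ≡ xorSum (λ i → P i (inj₁ w) ∧ F (lab B i) y)
    rows (inj₁ (inj₁ a)) y = row (inj₁ a) y
    rows (inj₁ (inj₂ _)) y = sym (xorSum-false {rk B} λ _ → refl)
    rows (inj₂ (inj₁ b)) y = row (inj₂ b) y
    rows (inj₂ (inj₂ _)) y = sym (xorSum-false {rk B} λ _ → refl)

    -- The correction sum reproduces the cut entry, and in characteristic 2 the two cancel.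
    vanish : ∀ w y → onTops l r (λ z → F (topLab l r z) y) w xor
                     xorSum (λ i → (P i (inj₁ w) ∧ F (lab B i) y) xor (false ∧ false)) ≡ false
    vanish w y = trans (cong₂ _xor_ (rows w y)
                         (xorSum-cong {rk B} λ i → xor-identityʳ (P i (inj₁ w) ∧ F (lab B i) y)))
                       (xor-same (xorSum λ i → P i (inj₁ w) ∧ F (lab B i) y))

    e : ∀ x y → expandAll (expanded₂ F D l r) P Q x y ≡ expanded F D B (f x) (f y)
    e (inj₁ i)        (inj₁ j)               = refl
    e (inj₁ i)        (inj₂ (inj₁ j))        = refl
    e (inj₁ i)        (inj₂ (inj₂ (inj₁ w))) = refl
    e (inj₁ i)        (inj₂ (inj₂ (inj₂ y))) = refl
    e (inj₂ (inj₁ i)) (inj₁ j)               = refl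
    e (inj₂ (inj₁ i)) (inj₂ (inj₁ j))        = refl
    e (inj₂ (inj₁ i)) (inj₂ (inj₂ (inj₁ w))) = refl
    e (inj₂ (inj₁ i)) (inj₂ (inj₂ (inj₂ y))) = refl
    e (inj₂ (inj₂ (inj₁ w))) (inj₁ j)        = refl
    e (inj₂ (inj₂ (inj₁ w))) (inj₂ (inj₁ j)) = refl
    e (inj₂ (inj₂ (inj₂ y))) (inj₁ j)        = refl
    e (inj₂ (inj₂ (inj₂ y))) (inj₂ (inj₁ j)) = refl
    e (inj₂ (inj₂ (inj₁ w))) (inj₂ (inj₂ (inj₁ u))) =
      trans (cong (joined l r w u xor_) (xorSum-false {rk B} λ i →
             trans (xor-identityʳ (P i (inj₁ w) ∧ false)) (∧-zeroʳ (P i (inj₁ w)))))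
            (xor-identityʳ _)
    e (inj₂ (inj₂ (inj₁ w))) (inj₂ (inj₂ (inj₂ y))) = vanish w y
    e (inj₂ (inj₂ (inj₂ y))) (inj₂ (inj₂ (inj₁ w))) =
      trans (cong (onTops l r (λ z → F (topLab l r z) y) w xor_)
              (xorSum-cong {rk B} λ i →
               trans (∧-comm (F (lab B i) y) (P i (inj₁ w)))
                     (sym (xor-identityʳ (P i (inj₁ w) ∧ F (lab B i) y)))))
            (vanish w y)
    e (inj₂ (inj₂ (inj₂ y))) (inj₂ (inj₂ (inj₂ y′))) =
      trans (cong (D y y′ xor_) (xorSum-false {rk B} λ i → ∧-zeroʳ (F (lab B i) y))) (xor-identityʳ _)

  realise₂ {Y} F D l r out (l∩r , disjˡ , disjʳ) R =
    relabel f₃ g₃ fg₃ gf₃ e₃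
      (realise F₂ (expanded F D l) r outʳ disjʳ
        (relabel f₂ g₂ fg₂ gf₂ e₂
          (realise F₁ (original F D r) l outˡ disjˡ
            (relabel f₁ g₁ fg₁ gf₁ e₁ R))))
    where
    F₁ : Fin n → Leaf r ⊎ Y → Bool
    F₁ u (inj₁ x) = adj G u (label r x)
    F₁ u (inj₂ y) = F u y
    F₂ : Fin n → V l ⊎ Y → Bool
    F₂ u (inj₁ v) = onTop l (λ a → adj G u (lab l a)) v
    F₂ u (inj₂ y) = F u y

    outˡ : ColumnsOutside l F₁
    outˡ (inj₁ x) = inj₁ (label r x , (λ p → l∩r p (label-∈ r x)) , λ u → refl)
    outˡ (inj₂ y) with out y
    ... | inj₁ (c , c∉ , e) = inj₁ (c , c∉ ∘ left , e)
    ... | inj₂ e            = inj₂ e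
    outʳ : ColumnsOutside r F₂
    outʳ (inj₁ (inj₁ a)) = inj₁ (lab l a , (λ p → l∩r (lab-∈ l a) p) , λ u → refl)
    outʳ (inj₁ (inj₂ _)) = inj₂ λ u → refl
    outʳ (inj₂ y) with out y
    ... | inj₁ (c , c∉ , e) = inj₁ (c , c∉ ∘ right , e)
    ... | inj₂ e            = inj₂ e

    f₁ : (Leaf l ⊎ Leaf r) ⊎ Y → Leaf l ⊎ Leaf r ⊎ Y
    f₁ = assocʳ
    g₁ : Leaf l ⊎ Leaf r ⊎ Y → (Leaf l ⊎ Leaf r) ⊎ Y
    g₁ = assocˡ
    fg₁ : ∀ w → f₁ (g₁ w) ≡ w
    fg₁ (inj₁ x)        = refl
    fg₁ (inj₂ (inj₁ x)) = refl
    fg₁ (inj₂ (inj₂ y)) = refl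
    gf₁ : ∀ w → g₁ (f₁ w) ≡ w
    gf₁ (inj₁ (inj₁ x)) = refl
    gf₁ (inj₁ (inj₂ x)) = refl
    gf₁ (inj₂ y)        = refl
    e₁ : ∀ x y → original F D (node l r) x y ≡ original F₁ (original F D r) l (f₁ x) (f₁ y)
    e₁ (inj₁ (inj₁ x)) (inj₁ (inj₁ y)) = refl
    e₁ (inj₁ (inj₁ x)) (inj₁ (inj₂ y)) = refl
    e₁ (inj₁ (inj₁ x)) (inj₂ y)        = refl
    e₁ (inj₁ (inj₂ x)) (inj₁ (inj₁ y)) = adj-sym G _ _
    e₁ (inj₁ (inj₂ x)) (inj₁ (inj₂ y)) = refl
    e₁ (inj₁ (inj₂ x)) (inj₂ y)        = refl
    e₁ (inj₂ x)        (inj₁ (inj₁ y)) = refl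
    e₁ (inj₂ x)        (inj₁ (inj₂ y)) = refl
    e₁ (inj₂ x)        (inj₂ y)        = refl

    f₂ : V l ⊎ Leaf r ⊎ Y → Leaf r ⊎ V l ⊎ Y
    f₂ (inj₁ v)        = inj₂ (inj₁ v)
    f₂ (inj₂ (inj₁ x)) = inj₁ x
    f₂ (inj₂ (inj₂ y)) = inj₂ (inj₂ y)
    g₂ : Leaf r ⊎ V l ⊎ Y → V l ⊎ Leaf r ⊎ Y
    g₂ (inj₁ x)        = inj₂ (inj₁ x)
    g₂ (inj₂ (inj₁ v)) = inj₁ v
    g₂ (inj₂ (inj₂ y)) = inj₂ (inj₂ y)
    fg₂ : ∀ w → f₂ (g₂ w) ≡ w
    fg₂ (inj₁ x)        = refl
    fg₂ (inj₂ (inj₁ v)) = refl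
    fg₂ (inj₂ (inj₂ y)) = refl
    gf₂ : ∀ w → g₂ (f₂ w) ≡ w
    gf₂ (inj₁ v)        = refl
    gf₂ (inj₂ (inj₁ x)) = refl
    gf₂ (inj₂ (inj₂ y)) = refl
    e₂ : ∀ x y → expanded F₁ (original F D r) l x y ≡ original F₂ (expanded F D l) r (f₂ x) (f₂ y)
    e₂ (inj₁ v)        (inj₁ w)        = refl
    e₂ (inj₁ v)        (inj₂ (inj₁ x)) = onTop-cong l (λ a → adj-sym G _ _) v
    e₂ (inj₁ v)        (inj₂ (inj₂ y)) = refl
    e₂ (inj₂ (inj₁ x)) (inj₁ v)        = onTop-cong l (λ a → adj-sym G _ _) v
    e₂ (inj₂ (inj₁ x)) (inj₂ (inj₁ y)) = refl
    e₂ (inj₂ (inj₁ x)) (inj₂ (inj₂ y)) = refl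
    e₂ (inj₂ (inj₂ x)) (inj₁ v)        = refl
    e₂ (inj₂ (inj₂ x)) (inj₂ (inj₁ y)) = refl
    e₂ (inj₂ (inj₂ x)) (inj₂ (inj₂ y)) = refl

    f₃ : V r ⊎ V l ⊎ Y → (V l ⊎ V r) ⊎ Y
    f₃ (inj₁ w)        = inj₁ (inj₂ w)
    f₃ (inj₂ (inj₁ v)) = inj₁ (inj₁ v)
    f₃ (inj₂ (inj₂ y)) = inj₂ y
    g₃ : (V l ⊎ V r) ⊎ Y → V r ⊎ V l ⊎ Y
    g₃ (inj₁ (inj₂ w)) = inj₁ w
    g₃ (inj₁ (inj₁ v)) = inj₂ (inj₁ v)
    g₃ (inj₂ y)        = inj₂ (inj₂ y)
    fg₃ : ∀ w → f₃ (g₃ w) ≡ w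
    fg₃ (inj₁ (inj₂ w)) = refl
    fg₃ (inj₁ (inj₁ v)) = refl
    fg₃ (inj₂ y)        = refl
    gf₃ : ∀ w → g₃ (f₃ w) ≡ w
    gf₃ (inj₁ w)        = refl
    gf₃ (inj₂ (inj₁ v)) = refl
    gf₃ (inj₂ (inj₂ y)) = refl
    e₃ : ∀ x y → expanded F₂ (expanded F D l) r x y ≡ expanded₂ F D l r (f₃ x) (f₃ y)
    e₃ (inj₁ w)        (inj₁ w′)       = refl
    e₃ (inj₁ w)        (inj₂ (inj₁ v)) = refl
    e₃ (inj₁ w)        (inj₂ (inj₂ y)) = refl
    e₃ (inj₂ (inj₁ v)) (inj₁ w)        = refl
    e₃ (inj₂ (inj₁ v)) (inj₂ (inj₁ u)) = refl
    e₃ (inj₂ (inj₁ v)) (inj₂ (inj₂ y)) = refl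
    e₃ (inj₂ (inj₂ x)) (inj₁ w)        = refl
    e₃ (inj₂ (inj₂ x)) (inj₂ (inj₁ v)) = refl
    e₃ (inj₂ (inj₂ x)) (inj₂ (inj₂ y)) = refl

-- Equality tests, walks, edge deletion and counting

==⇒≡ : ∀ {n} {x y : Fin n} → (x == y) ≡ true → x ≡ y
==⇒≡ {x = x} {y} p with x ≟ y
... | yes e = e

==-refl : ∀ {n} (x : Fin n) → (x == x) ≡ true
==-refl x with x ≟ x
... | yes _ = refl
... | no ¬e = ⊥-elim (¬e refl)

≢⇒== : ∀ {n} {x y : Fin n} → x ≢ y → (x == y) ≡ false
≢⇒== {x = x} {y} x≢y with x ≟ y
... | yes e = ⊥-elim (x≢y e)
... | no _  = refl

true≢false : ∀ {b} → b ≡ true → b ≢ false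
true≢false refl ()

Relation : ℕ → Set
Relation t = Fin t → Fin t → Bool

removeEdge-true : ∀ {t} (A : Relation t) {u v x y} → removeEdge A u v x y ≡ true →
  A x y ≡ true × ¬ (x ≡ u × y ≡ v) × ¬ (x ≡ v × y ≡ u)
removeEdge-true A {u} {v} {x} {y} p with A x y | x ≟ u | y ≟ v | x ≟ v | y ≟ u
... | true | no x≢u | _      | no x≢v | _      = refl , (λ (e , _) → x≢u e) , (λ (e , _) → x≢v e)
... | true | no x≢u | _      | yes _  | no y≢u = refl , (λ (e , _) → x≢u e) , (λ (_ , e) → y≢u e)
... | true | yes _  | no y≢v | no x≢v | _      = refl , (λ (_ , e) → y≢v e) , (λ (e , _) → x≢v e)
... | true | yes _  | no y≢v | yes _  | no y≢u = refl , (λ (_ , e) → y≢v e) , (λ (_ , e) → y≢u e)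

true-removeEdge : ∀ {t} (A : Relation t) {u v x y} →
  A x y ≡ true → ¬ (x ≡ u × y ≡ v) → ¬ (x ≡ v × y ≡ u) → removeEdge A u v x y ≡ true
true-removeEdge A {u} {v} {x} {y} p q r with A x y | x ≟ u | y ≟ v | x ≟ v | y ≟ u
... | true | yes e  | yes f  | _      | _      = ⊥-elim (q (e , f))
... | true | _      | _      | yes e  | yes f  = ⊥-elim (r (e , f))
... | true | no _   | _      | no _   | _      = refl
... | true | no _   | _      | yes _  | no _   = refl
... | true | yes _  | no _   | no _   | _      = refl
... | true | yes _  | no _   | yes _  | no _   = refl

mapWalk : ∀ {s t} {A : Relation s} {B : Relation t} {P : Fin s → Set} {Q : Fin t → Set}
  (f : Fin s → Fin t) → (∀ {x y} → A x y ≡ true → B (f x) (f y) ≡ true) →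
  (∀ {x} → P x → Q (f x)) → ∀ {x y} → Walk A P x y → Walk B Q (f x) (f y)
mapWalk f α π (stop p)     = stop (π p)
mapWalk f α π (step p e w) = step (π p) (α e) (mapWalk f α π w)

module _ {t : ℕ} {A : Relation t} {P : Fin t → Set} where

  start-∈ : ∀ {x y} → Walk A P x y → P x
  start-∈ (stop p)     = p
  start-∈ (step p _ _) = p

  _⁀_ : ∀ {x y z} → Walk A P x y → Walk A P y z → Walk A P x z
  stop _     ⁀ w′ = w′
  step p e w ⁀ w′ = step p e (w ⁀ w′)

  snoc : ∀ {x y z} → Walk A P x y → A y z ≡ true → P z → Walk A P x z
  snoc (stop p)     e q = step p e (stop q)
  snoc (step p f w) e q = step p f (snoc w e q)

  reverseWalk : (∀ x y → A x y ≡ A y x) → ∀ {x y} → Walk A P x y → Walk A P y x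
  reverseWalk s (stop p)     = stop p
  reverseWalk s (step p e w) = snoc (reverseWalk s w) (trans (s _ _) e) p

removeEdge-flip : ∀ {t} (A : Relation t) → (∀ x y → A x y ≡ A y x) → ∀ {u v} →
  Reach (removeEdge A u v) u v → Reach (removeEdge A v u) v u
removeEdge-flip A s {u} {v} w = reverseWalk symmetric (mapWalk id swap id w)
  where
  swap : ∀ {x y} → removeEdge A u v x y ≡ true → removeEdge A v u x y ≡ true
  swap e = let p , q , r = removeEdge-true A e in true-removeEdge A p r q
  symmetric : ∀ x y → removeEdge A v u x y ≡ removeEdge A v u y x
  symmetric x y with removeEdge A v u x y in e | removeEdge A v u y x in f
  ... | true  | true  = refl
  ... | false | false = refl
  ... | true  | false = let p , q , r = removeEdge-true A e in
    ⊥-elim (true≢false (true-removeEdge A (trans (s y x) p) (λ (a , b) → r (b , a)) (λ (a , b) → q (b , a))) f)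
  ... | false | true  = let p , q , r = removeEdge-true A f in
    ⊥-elim (true≢false (true-removeEdge A (trans (s x y) p) (λ (a , b) → r (b , a)) (λ (a , b) → q (b , a))) e)

_without_ : ∀ {n} → (Fin n → Bool) → Fin n → Fin n → Bool
(f without u) x = f x ∧ not (x == u)

countTrue-cong : ∀ {n} {f g : Fin n → Bool} → (∀ x → f x ≡ g x) → countTrue f ≡ countTrue g
countTrue-cong {zero}  e = refl
countTrue-cong {suc n} {f} {g} e with f zero | g zero | e zero
... | true  | .true  | refl = cong suc (countTrue-cong (e ∘ suc))
... | false | .false | refl = countTrue-cong (e ∘ suc)

countTrue-without : ∀ {n} (f : Fin n → Bool) u → f u ≡ true → countTrue f ≡ suc (countTrue (f without u))
countTrue-without {suc n} f zero    p rewrite p = cong suc (countTrue-cong {n} λ x → sym (∧-identityʳ (f (suc x))))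
countTrue-without {suc n} f (suc u) p with f zero | tail-count
  where
  tail-count : countTrue (f ∘ suc) ≡ suc (countTrue ((f without suc u) ∘ suc))
  tail-count = trans (countTrue-without (f ∘ suc) u p)
    (cong suc (countTrue-cong λ x → cong (λ b → f (suc x) ∧ not b) (sym (suc-==-suc x u))))
... | true  | e = cong suc e
... | false | e = e

countTrue-false : ∀ {n} (f : Fin n → Bool) → (∀ x → f x ≡ false) → countTrue f ≡ 0
countTrue-false {zero}  f e = refl
countTrue-false {suc n} f e rewrite e zero = countTrue-false (f ∘ suc) (e ∘ suc)

without-true : ∀ {n} (f : Fin n → Bool) {u x} → (f without u) x ≡ true → f x ≡ true × x ≢ u
without-true f {u} {x} p with f x | x ≟ u
... | true | no ¬e = refl , ¬e

true-without : ∀ {n} (f : Fin n → Bool) {u x} → f x ≡ true → x ≢ u → (f without u) x ≡ true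
true-without f p x≢u rewrite p | ≢⇒== x≢u = refl

-- Bags are lists and may repeat vertices; an upper bound by the length is the direction that the
-- width needs.
countTrue-≤-length : ∀ {n} (f : Fin n → Bool) xs → (∀ x → f x ≡ true → x ∈ˡ xs) → countTrue f ≤ length xs
countTrue-≤-length f [] f⊆ = ≤-reflexive (countTrue-false f λ x → none x)
  where
  none : ∀ x → f x ≡ false
  none x with f x in e
  ... | false = refl
  ... | true with () ← f⊆ x e
countTrue-≤-length f (y ∷ ys) f⊆ with f y in e
... | true  = ≤-trans (≤-reflexive (countTrue-without f y e)) (s≤s (countTrue-≤-length (f without y) ys g⊆))
  where
  g⊆ : ∀ x → (f without y) x ≡ true → x ∈ˡ ys
  g⊆ x p with without-true f p
  ... | fx , x≢y with f⊆ x fx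
  ...   | here x≡y = ⊥-elim (x≢y x≡y)
  ...   | there q  = q
... | false = m≤n⇒m≤1+n (countTrue-≤-length f ys g⊆)
  where
  g⊆ : ∀ x → f x ≡ true → x ∈ˡ ys
  g⊆ x fx with f⊆ x fx
  ... | here refl = ⊥-elim (true≢false fx e)
  ... | there q   = q

-- Tree-decompositions

data BagTree (X : Set) : Set where
  single : List X → BagTree X
  extend : List X → BagTree X → BagTree X
  fork   : List X → BagTree X → BagTree X → BagTree X

root : ∀ {X} → BagTree X → List X
root (single b)   = b
root (extend b T) = b
root (fork b T U) = b

-- Covering a vertex is the diagonal case of covering a pair, so one relation serves both axioms of
-- a tree-decomposition.
Together : ∀ {X} → BagTree X → X → X → Set
Together (single b)   x y = x ∈ˡ b × y ∈ˡ b
Together (extend b T) x y = (x ∈ˡ b × y ∈ˡ b) ⊎ Together T x y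
Together (fork b T U) x y = (x ∈ˡ b × y ∈ˡ b) ⊎ Together T x y ⊎ Together U x y

Occurs : ∀ {X} → BagTree X → X → Set
Occurs T x = Together T x x

root-together : ∀ {X} (T : BagTree X) {x y} → x ∈ˡ root T → y ∈ˡ root T → Together T x y
root-together (single b)   p q = p , q
root-together (extend b T) p q = inj₁ (p , q)
root-together (fork b T U) p q = inj₁ (p , q)

Together-sym : ∀ {X} (T : BagTree X) {x y} → Together T x y → Together T y x
Together-sym (single b)   (p , q)          = q , p
Together-sym (extend b T) (inj₁ (p , q))   = inj₁ (q , p)
Together-sym (extend b T) (inj₂ p)         = inj₂ (Together-sym T p)
Together-sym (fork b T U) (inj₁ (p , q))   = inj₁ (q , p)
Together-sym (fork b T U) (inj₂ (inj₁ p))  = inj₂ (inj₁ (Together-sym T p))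
Together-sym (fork b T U) (inj₂ (inj₂ p))  = inj₂ (inj₂ (Together-sym U p))

-- Below a bag b, no vertex of b may reappear after having been dropped: together with the analogous
-- condition on siblings in Valid, this makes the bags containing a given vertex connected.
Hangs : ∀ {X} → List X → BagTree X → Set
Hangs b T = ∀ {x} → x ∈ˡ b → Occurs T x → x ∈ˡ root T

Valid : ∀ {X} → ℕ → BagTree X → Set
Valid s (single b)   = length b ≤ s
Valid s (extend b T) = length b ≤ s × Hangs b T × Valid s T
Valid s (fork b T U) =
  length b ≤ s × Hangs b T × Hangs b U × (∀ {x} → Occurs T x → Occurs U x → x ∈ˡ b) × Valid s T × Valid s U

mapTree : ∀ {X Y} → (X → Y) → BagTree X → BagTree Y
mapTree f (single b)   = single (map f b)
mapTree f (extend b T) = extend (map f b) (mapTree f T)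
mapTree f (fork b T U) = fork (map f b) (mapTree f T) (mapTree f U)

module _ {X Y : Set} (f : X → Y) where

  root-map : ∀ T {x} → x ∈ˡ root T → f x ∈ˡ root (mapTree f T)
  root-map (single b)   = ∈-map⁺ f
  root-map (extend b T) = ∈-map⁺ f
  root-map (fork b T U) = ∈-map⁺ f

  Together-map : ∀ T {x y} → Together T x y → Together (mapTree f T) (f x) (f y)
  Together-map (single b)   (p , q)         = ∈-map⁺ f p , ∈-map⁺ f q
  Together-map (extend b T) (inj₁ (p , q))  = inj₁ (∈-map⁺ f p , ∈-map⁺ f q)
  Together-map (extend b T) (inj₂ p)        = inj₂ (Together-map T p)
  Together-map (fork b T U) (inj₁ (p , q))  = inj₁ (∈-map⁺ f p , ∈-map⁺ f q)
  Together-map (fork b T U) (inj₂ (inj₁ p)) = inj₂ (inj₁ (Together-map T p))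
  Together-map (fork b T U) (inj₂ (inj₂ p)) = inj₂ (inj₂ (Together-map U p))

  private
    from-bag : ∀ {b y} → y ∈ˡ map f b → ∃ λ x → y ≡ f x × (x ∈ˡ b × x ∈ˡ b)
    from-bag p = let x , q , e = ∈-map⁻ f p in x , e , q , q

  Occurs-map⁻ : ∀ T {y} → Occurs (mapTree f T) y → ∃ λ x → y ≡ f x × Occurs T x
  Occurs-map⁻ (single b)   (p , _)         = from-bag p
  Occurs-map⁻ (extend b T) (inj₁ (p , _))  = let x , e , q = from-bag p in x , e , inj₁ q
  Occurs-map⁻ (extend b T) (inj₂ p)        = let x , e , q = Occurs-map⁻ T p in x , e , inj₂ q
  Occurs-map⁻ (fork b T U) (inj₁ (p , _))  = let x , e , q = from-bag p in x , e , inj₁ q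
  Occurs-map⁻ (fork b T U) (inj₂ (inj₁ p)) = let x , e , q = Occurs-map⁻ T p in x , e , inj₂ (inj₁ q)
  Occurs-map⁻ (fork b T U) (inj₂ (inj₂ p)) = let x , e , q = Occurs-map⁻ U p in x , e , inj₂ (inj₂ q)

  module _ (f-inj : ∀ {x y} → f x ≡ f y → x ≡ y) where

    Hangs-map : ∀ {b} T → Hangs b T → Hangs (map f b) (mapTree f T)
    Hangs-map T h p o with ∈-map⁻ f p | Occurs-map⁻ T o
    ... | x , q , refl | x′ , e , o′ with refl ← f-inj e = root-map T (h q o′)

    Valid-map : ∀ {s} T → Valid s T → Valid s (mapTree f T)
    Valid-map {s} (single b)   v = subst (_≤ s) (sym (length-map f b)) v
    Valid-map {s} (extend b T) (v , h , vT) =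
      subst (_≤ s) (sym (length-map f b)) v , Hangs-map T h , Valid-map T vT
    Valid-map {s} (fork b T U) (v , hT , hU , meet , vT , vU) =
      subst (_≤ s) (sym (length-map f b)) v , Hangs-map T hT , Hangs-map U hU , meet′ ,
      Valid-map T vT , Valid-map U vU
      where
      meet′ : ∀ {y} → Occurs (mapTree f T) y → Occurs (mapTree f U) y → y ∈ˡ map f b
      meet′ p q with Occurs-map⁻ T p | Occurs-map⁻ U q
      ... | x , refl , o | x′ , e , o′ with refl ← f-inj e = ∈-map⁺ f (meet o o′)

-- The slots sel i of a bag σ are overwritten by new i in the order of i, so that new i still meets
-- every slot that is not overwritten before step i.
record Replacement {X : Set} (s : ℕ) (T : BagTree X) {N q : ℕ}
                   (σ : Fin N → X) (sel : Fin q → Fin N) (new : Fin q → X) : Set where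
  field
    tree    : BagTree X
    valid   : Valid s tree
    keeps   : ∀ {x y} → Together T x y → Together tree x y
    origin  : ∀ {x} → Occurs tree x → Occurs T x ⊎ ∃ λ i → x ≡ new i
    old-root : ∀ z → (∀ j → sel j ≢ z) → σ z ∈ˡ root tree
    new-root : ∀ i → new i ∈ˡ root tree
    meets   : ∀ i z → (∀ j → sel j ≡ z → j ≡ i) → Together tree (new i) (σ z)

-- Each step stacks one bag made of the `N` current slots and one newcomer, which explains
-- `suc N ≤ s`. Since the newcomers are fresh, no vertex reappears after having been dropped.
replace : ∀ {X : Set} {s N q} (T : BagTree X) (σ : Fin N → X) (sel : Fin q → Fin N) (new : Fin q → X) →
  suc N ≤ s → Valid s T → (∀ z → σ z ∈ˡ root T) →
  (∀ {i j} → sel i ≡ sel j → i ≡ j) → (∀ {i j} → new i ≡ new j → i ≡ j) → (∀ i → ¬ Occurs T (new i)) →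
  Replacement s T σ sel new
replace {q = zero} T σ sel new s≥ v σ∈ sel-inj new-inj fresh = record
  { tree = T ; valid = v ; keeps = id ; origin = inj₁ ; old-root = λ z _ → σ∈ z
  ; new-root = λ () ; meets = λ () }
replace {X} {s} {N} {suc q} T σ sel new s≥ v σ∈ sel-inj new-inj fresh = record
  { tree = tree
  ; valid = valid
  ; keeps = keeps ∘ inj₂
  ; origin = origin′
  ; old-root = λ z z∉ → subst (_∈ˡ root tree) (σ′-other (z∉ zero ∘ sym)) (old-root z (z∉ ∘ suc))
  ; new-root = λ { zero → subst (_∈ˡ root tree) σ′-self
                            (old-root (sel zero) λ j e → suc≢zero (sel-inj e))
                 ; (suc i) → new-root i }
  ; meets = λ { zero z _ → keeps (inj₁ (here refl , there (∈-tabulate⁺ z)))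
              ; (suc i) z z∉ → subst (Together tree (new (suc i)))
                  (σ′-other λ e → suc≢zero (sym (z∉ zero (sym e))))
                  (meets i z λ j e → suc-inj (z∉ (suc j) e)) }
  }
  where
  suc≢zero : ∀ {n} {j : Fin n} → Fin.suc j ≢ zero
  suc≢zero ()
  suc-inj : ∀ {n} {i j : Fin n} → Fin.suc i ≡ suc j → i ≡ j
  suc-inj refl = refl
  b : List X
  -- The slot being overwritten is still in this bag, so the newcomer meets its predecessor; it is
  -- missing only from the next bag.
  b = new zero ∷ tabulate σ
  σ′ : Fin N → X
  σ′ = updateAt σ (sel zero) (λ _ → new zero)
  σ′-self : σ′ (sel zero) ≡ new zero
  σ′-self = updateAt-updates (sel zero) σ
  σ′-other : ∀ {z} → z ≢ sel zero → σ′ z ≡ σ z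
  σ′-other = updateAt-minimal _ (sel zero) σ
  σ′∈ : ∀ z → σ′ z ∈ˡ b
  σ′∈ z with z ≟ sel zero
  ... | yes refl = here σ′-self
  ... | no z≢    = there (subst (_∈ˡ tabulate σ) (sym (σ′-other z≢)) (∈-tabulate⁺ z))
  bag-origin : ∀ {x} → x ∈ˡ b → x ≡ new zero ⊎ x ∈ˡ root T
  bag-origin (here e) = inj₁ e
  bag-origin (there p) with z , refl ← ∈-tabulate⁻ p = inj₂ (σ∈ z)
  hangs : Hangs b T
  hangs p o with bag-origin p
  ... | inj₁ refl = ⊥-elim (fresh zero o)
  ... | inj₂ r    = r
  fresh′ : ∀ i → ¬ Occurs (extend b T) (new (suc i))
  fresh′ i (inj₂ o)       = fresh (suc i) o
  fresh′ i (inj₁ (p , _)) with bag-origin p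
  ... | inj₁ e = suc≢zero (new-inj e)
  ... | inj₂ r = fresh (suc i) (root-together T r r)
  open Replacement (replace (extend b T) σ′ (sel ∘ suc) (new ∘ suc) s≥
    (subst (_≤ s) (cong suc (sym (length-tabulate σ))) s≥ , hangs , v) σ′∈
    (suc-inj ∘ sel-inj) (suc-inj ∘ new-inj) fresh′)
  origin′ : ∀ {x} → Occurs tree x → Occurs T x ⊎ ∃ λ i → x ≡ new i
  origin′ o with origin o
  ... | inj₂ (i , e) = inj₂ (suc i , e)
  ... | inj₁ (inj₂ o′) = inj₁ o′
  ... | inj₁ (inj₁ (p , _)) with bag-origin p
  ...   | inj₁ e = inj₂ (zero , e)
  ...   | inj₂ r = inj₁ (root-together T r r)

-- Trees grown leaf by leaf, and gluing bag trees onto them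

data PointerTree : ℕ → Set where
  point : PointerTree 1
  grow  : ∀ {t} → PointerTree t → Fin t → PointerTree (suc t)

linked : ∀ {t} → PointerTree t → Relation t
linked point      _       _       = false
linked (grow p a) zero    zero    = false
linked (grow p a) zero    (suc j) = j == a
linked (grow p a) (suc i) zero    = i == a
linked (grow p a) (suc i) (suc j) = linked p i j

linked-sym : ∀ {t} (p : PointerTree t) x y → linked p x y ≡ linked p y x
linked-sym point      x       y       = refl
linked-sym (grow p a) zero    zero    = refl
linked-sym (grow p a) zero    (suc j) = refl
linked-sym (grow p a) (suc i) zero    = refl
linked-sym (grow p a) (suc i) (suc j) = linked-sym p i j

linked-irrefl : ∀ {t} (p : PointerTree t) x → linked p x x ≡ false
linked-irrefl point      x       = refl
linked-irrefl (grow p a) zero    = refl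
linked-irrefl (grow p a) (suc i) = linked-irrefl p i

pointerGraph : ∀ {t} → PointerTree t → Graph t
pointerGraph p = record { adj = linked p ; adj-sym = linked-sym p ; adj-irrefl = linked-irrefl p }

linked-nonempty : ∀ {t} → PointerTree t → 1 ≤ t
linked-nonempty point      = s≤s z≤n
linked-nonempty (grow p a) = s≤s z≤n

linked-connected : ∀ {t} (p : PointerTree t) x y → Reach (linked p) x y
linked-connected point      zero    zero    = stop tt
linked-connected (grow p a) zero    zero    = stop tt
linked-connected (grow p a) zero    (suc j) =
  step tt (==-refl a) (mapWalk suc id id (linked-connected p a j))
linked-connected (grow p a) (suc i) zero    =
  snoc (mapWalk suc id id (linked-connected p i a)) (==-refl a) tt
linked-connected (grow p a) (suc i) (suc j) = mapWalk suc id id (linked-connected p i j)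

-- The deleted edge is the only one at the leaf `zero`, so a walk cannot take its first step.
linked-acyclic₀ : ∀ {t} (p : PointerTree t) a j → (j == a) ≡ true →
  ¬ Reach (removeEdge (linked (grow p a)) zero (suc j)) zero (suc j)
linked-acyclic₀ p a j e (step {b = b} _ f w)
  with removeEdge-true (linked (grow p a)) {zero} {suc j} {zero} {b} f
linked-acyclic₀ p a j e (step {b = suc j′} _ f w) | g , h , _ =
  h (refl , cong suc (trans (==⇒≡ {x = j′} {a} g) (sym (==⇒≡ {x = j} {a} e))))

linked-acyclic : ∀ {t} (p : PointerTree t) u v → linked p u v ≡ true → ¬ Reach (removeEdge (linked p) u v) u v
linked-acyclic (grow p a) zero (suc j) e w = linked-acyclic₀ p a j e w
linked-acyclic (grow p a) (suc i) zero e w =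
  linked-acyclic₀ p a i e (removeEdge-flip (linked (grow p a)) (linked-sym (grow p a)) w)
linked-acyclic (grow p a) (suc i) (suc j) e w = linked-acyclic p i j e (retract w)
  where
  -- Retracting the newest leaf onto its neighbour turns a walk in the large tree into a walk in the
  -- smaller one; steps along the leaf's edge collapse.
  π : Fin _ → Fin _
  π zero    = a
  π (suc x) = x
  retract : ∀ {x y} → Reach (removeEdge (linked (grow p a)) (suc i) (suc j)) x y →
            Reach (removeEdge (linked p) i j) (π x) (π y)
  retract (stop _) = stop tt
  retract (step {x} {y} _ f w) with removeEdge-true (linked (grow p a)) {suc i} {suc j} {x} {y} f
  retract (step {zero} {suc y} _ f w) | g , _ with refl ← ==⇒≡ {x = y} {a} g = retract w
  retract (step {suc x} {zero} _ f w) | g , _ with refl ← ==⇒≡ {x = x} {a} g = retract w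
  retract (step {suc x} {suc y} _ f w) | g , h , k =
    step tt (true-removeEdge (linked p) {i} {j} {x} {y} g (λ (q , r) → h (cong suc q , cong suc r))
                                          (λ (q , r) → k (cong suc q , cong suc r))) (retract w)

record BagForest (m s : ℕ) : Set where
  field
    {nodes} : ℕ
    shape   : PointerTree nodes
    bag     : Fin nodes → List (Fin m)
    bag≤ : ∀ a → length (bag a) ≤ s
    convex  : ∀ x a b → x ∈ˡ bag a → x ∈ˡ bag b → Walk (linked shape) (λ c → x ∈ˡ bag c) a b
  Present : Fin m → Set
  Present x = ∃ λ a → x ∈ˡ bag a
open BagForest

-- `R` relates the pairs covered by the added bags. `present` also bounds what was added, because
-- later gluing must know where a vertex already present can have come from.
record Growth {m s : ℕ} (S : BagForest m s) (R : Fin m → Fin m → Set) : Set where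
  field
    result : BagForest m s
    embed  : Fin (nodes S) → Fin (nodes result)
    embed-bag : ∀ a → bag result (embed a) ≡ bag S a
    present   : ∀ {x} → Present result x → Present S x ⊎ R x x
    cover    : ∀ {x y} → R x y → ∃ λ a → x ∈ˡ bag result a × y ∈ˡ bag result a
open Growth

-- The last hypothesis is what convexity requires: a vertex shared with the older bags must lie in
-- the neighbouring bag `a`.
addBag : ∀ {m s} (S : BagForest m s) a b → length b ≤ s →
  (∀ {x} → x ∈ˡ b → Present S x → x ∈ˡ bag S a) →
  Σ (Growth S (λ x y → x ∈ˡ b × y ∈ˡ b)) λ E → Σ (Fin (nodes (result E))) λ c → bag (result E) c ≡ b
addBag {m} {s} S a b b≤ glue = record
  { result = record
    { shape = shape′ ; bag = bag′
    ; bag≤ = λ { zero → b≤ ; (suc c) → bag≤ S c }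
    ; convex = convex′ }
  ; embed = suc
  ; embed-bag = λ _ → refl
  ; present = λ { (zero , p) → inj₂ (p , p) ; (suc c , p) → inj₁ (c , p) }
  ; cover = λ (p , q) → zero , p , q
  } , zero , refl
  where
  shape′ : PointerTree (suc (nodes S))
  shape′ = grow (shape S) a
  bag′ : Fin (suc (nodes S)) → List (Fin m)
  bag′ zero    = b
  bag′ (suc c) = bag S c
  convex′ : ∀ x c d → x ∈ˡ bag′ c → x ∈ˡ bag′ d → Walk (linked shape′) (λ c → x ∈ˡ bag′ c) c d
  convex′ x zero zero p q = stop p
  convex′ x zero (suc d) p q =
    step p (==-refl a) (mapWalk suc id id (convex S x a d (glue p (d , q)) q))
  convex′ x (suc c) zero p q =
    snoc (mapWalk suc id id (convex S x c a p (glue q (c , p)))) (==-refl a) q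
  convex′ x (suc c) (suc d) p q = mapWalk suc id id (convex S x c d p q)

_⟫_ : ∀ {m s} {S : BagForest m s} {R Q : Fin m → Fin m → Set} (E : Growth S R) → Growth (result E) Q →
  Growth S (λ x y → R x y ⊎ Q x y)
_⟫_ {S = S} {R} {Q} E F = record
  { result = result F
  ; embed = embed F ∘ embed E
  ; embed-bag = λ a → trans (embed-bag F (embed E a)) (embed-bag E a)
  ; present = present′
  ; cover = cover′
  }
  where
  present′ : ∀ {x} → Present (result F) x → Present S x ⊎ R x x ⊎ Q x x
  present′ p with present F p
  ... | inj₂ q = inj₂ (inj₂ q)
  ... | inj₁ p′ with present E p′
  ...   | inj₁ r = inj₁ r
  ...   | inj₂ r = inj₂ (inj₁ r)
  cover′ : ∀ {x y} → R x y ⊎ Q x y → ∃ λ a → x ∈ˡ bag (result F) a × y ∈ˡ bag (result F) a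
  cover′ (inj₂ q) = cover F q
  cover′ {x} {y} (inj₁ r) with cover E r
  ... | a , p , q = embed F a , subst (x ∈ˡ_) (sym (embed-bag F a)) p , subst (y ∈ˡ_) (sym (embed-bag F a)) q

growTree : ∀ {m s} (T : BagTree (Fin m)) → Valid s T → (S : BagForest m s) (a : Fin (nodes S)) →
  (∀ {x} → Occurs T x → Present S x → x ∈ˡ root T × x ∈ˡ bag S a) → Growth S (Together T)
growTree (single b) v S a glue = proj₁ (addBag S a b v (λ p q → proj₂ (glue (p , p) q)))
growTree (extend b T) (b≤ , h , v) S a glue
  = E ⟫ growTree T v (result E) c glue′
  where
  added = addBag S a b b≤ (λ p q → proj₂ (glue (inj₁ (p , p)) q))
  E = proj₁ added
  c = proj₁ (proj₂ added)
  c≡ = proj₂ (proj₂ added)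
  glue′ : ∀ {x} → Occurs T x → Present (result E) x → x ∈ˡ root T × x ∈ˡ bag (result E) c
  glue′ {x} o p = h x∈b o , subst (x ∈ˡ_) (sym c≡) x∈b
    where
    x∈b : x ∈ˡ b
    x∈b with present E p
    ... | inj₁ q       = proj₁ (glue (inj₂ o) q)
    ... | inj₂ (q , _) = q
growTree (fork b T U) (b≤ , hT , hU , meet , vT , vU) S a glue
  -- `U` is attached after `T` has grown, so a vertex of `U` may already be present because of `T`;
  -- `meet` then places it in `b`, whose node is carried along by `embed F`.
  = E ⟫ (F ⟫ growTree U vU (result F) (embed F c) glueU)
  where
  added = addBag S a b b≤ (λ p q → proj₂ (glue (inj₁ (p , p)) q))
  E = proj₁ added
  c = proj₁ (proj₂ added)
  c≡ = proj₂ (proj₂ added)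
  glueT : ∀ {x} → Occurs T x → Present (result E) x → x ∈ˡ root T × x ∈ˡ bag (result E) c
  glueT {x} o p = hT x∈b o , subst (x ∈ˡ_) (sym c≡) x∈b
    where
    x∈b : x ∈ˡ b
    x∈b with present E p
    ... | inj₁ q       = proj₁ (glue (inj₂ (inj₁ o)) q)
    ... | inj₂ (q , _) = q
  F : Growth (result E) (Together T)
  F = growTree T vT (result E) c glueT
  glueU : ∀ {x} → Occurs U x → Present (result F) x → x ∈ˡ root U × x ∈ˡ bag (result F) (embed F c)
  glueU {x} o p = hU x∈b o , subst (x ∈ˡ_) (sym (trans (embed-bag F c) c≡)) x∈b
    where
    x∈b : x ∈ˡ b
    x∈b with present F p
    ... | inj₂ o′ = meet o′ o
    ... | inj₁ p′ with present E p′
    ...   | inj₁ q       = proj₁ (glue (inj₂ (inj₂ o)) q)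
    ...   | inj₂ (q , _) = q

treeDecomposition : ∀ {m w} (H : Graph m) (T : BagTree (Fin m)) → Valid (suc w) T →
  (∀ x → Occurs T x) → (∀ x y → adj H x y ≡ true → Together T x y) → TreeDecomposition H w
treeDecomposition {m} {w} H T v occurs edges = record
  { T = pointerGraph (shape S)
  ; tree = linked-nonempty (shape S) , linked-connected (shape S) , linked-acyclic (shape S)
  ; bag = bagᵇ
  ; covV = λ x → let a , p , _ = cover E (occurs x) in a , ∈⇒true p
  ; covE = λ x y e → let a , p , q = cover E (edges x y e) in a , ∈⇒true p , ∈⇒true q
  ; connected = λ x a b p q → mapWalk id id ∈⇒true (convex S x a b (true⇒∈ p) (true⇒∈ q))
  ; small = λ a → ≤-trans (countTrue-≤-length (bagᵇ a) (bag S a) (λ x → true⇒∈)) (bag≤ S a)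
  }
  where
  -- A single empty bag makes the first gluing condition vacuous.
  start : BagForest m (suc w)
  start = record { shape = point ; bag = λ _ → [] ; bag≤ = λ _ → z≤n ; convex = λ x a b () }
  E : Growth start (Together T)
  E = growTree T v start zero λ { _ (_ , ()) }
  S : BagForest m (suc w)
  S = result E
  bagᵇ : Fin (nodes S) → Fin m → Bool
  bagᵇ a x = ⌊ member? _≟_ x (bag S a) ⌋
  ∈⇒true : ∀ {a x} → x ∈ˡ bag S a → bagᵇ a x ≡ true
  ∈⇒true {a} {x} p with member? _≟_ x (bag S a)
  ... | yes _ = refl
  ... | no ¬p = ⊥-elim (¬p p)
  true⇒∈ : ∀ {a x} → bagᵇ a x ≡ true → x ∈ˡ bag S a
  true⇒∈ {a} {x} e with member? _≟_ x (bag S a)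
  ... | yes p = p

-- A tree-decomposition of the expansion

module Layouts {n : ℕ} (G : Graph n) (k : ℕ) where
  open Expansion G

  RankBounded : BinTree n → Set
  RankBounded (leaf x)   = 1 ≤ k
  RankBounded (node l r) = rk (node l r) ≤ k × RankBounded l × RankBounded r

  rank≤ : ∀ B → RankBounded B → rk B ≤ k
  rank≤ (leaf x)   1≤k     = 1≤k
  rank≤ (node l r) (q≤ , _) = q≤

  record Layout {X : Set} (A : X → X → Bool) : Set where
    field
      tree   : BagTree X
      valid  : Valid (suc (2 * k)) tree
      occurs : ∀ x → Occurs tree x
      edges  : ∀ x y → A x y ≡ true → Together tree x y
  open Layout

  top : ∀ l r → Fin (rk l) ⊎ Fin (rk r) → V l ⊎ V r
  top l r (inj₁ a) = inj₁ (inj₁ a)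
  top l r (inj₂ b) = inj₂ (inj₁ b)

  onTops-true : ∀ l r f w → onTops l r f w ≡ true → ∃ λ z → w ≡ top l r z × f z ≡ true
  onTops-true l r f (inj₁ (inj₁ a)) e = inj₁ a , refl , e
  onTops-true l r f (inj₂ (inj₁ b)) e = inj₂ b , refl , e

  slot : ∀ l r → Fin (rk l + rk r) → V l ⊎ V r
  slot l r z = top l r (splitAt (rk l) z)

  slot-join : ∀ l r z → slot l r (join (rk l) (rk r) z) ≡ top l r z
  slot-join l r z = cong (top l r) (splitAt-join (rk l) (rk r) z)

  slots : ∀ l r → List (V l ⊎ V r)
  slots l r = tabulate (slot l r)

  top∈slots : ∀ l r z → top l r z ∈ˡ slots l r
  top∈slots l r z = subst (_∈ˡ slots l r) (slot-join l r z) (∈-tabulate⁺ _)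

  slots≤ : ∀ l r → RankBounded l → RankBounded r → length (slots l r) ≤ 2 * k
  slots≤ l r bˡ bʳ = subst (_≤ 2 * k) (sym (length-tabulate (slot l r)))
    (+-mono-≤ (rank≤ l bˡ) (≤-trans (rank≤ r bʳ) (m≤m+n k 0)))

  -- Edges between siblings join upper copies only, and all of these fit into the fork bag. The root
  -- is returned exactly because the exchange above it starts from the full set of slots.
  joinedLayout : ∀ l r → RankBounded l → RankBounded r →
    (Λ : Layout (expansion l)) → (∀ i → inj₁ i ∈ˡ root (tree Λ)) →
    (Ρ : Layout (expansion r)) → (∀ i → inj₁ i ∈ˡ root (tree Ρ)) →
    Σ (Layout (joined l r)) λ L → root (tree L) ≡ slots l r
  joinedLayout l r bˡ bʳ Λ topˡ Ρ topʳ = record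
    { tree = fork (slots l r) T U
    ; valid = m≤n⇒m≤1+n (slots≤ l r bˡ bʳ) , hangsˡ , hangsʳ , meet
            , Valid-map inj₁ inj₁-injective (tree Λ) (valid Λ)
            , Valid-map inj₂ inj₂-injective (tree Ρ) (valid Ρ)
    ; occurs = λ { (inj₁ v) → inj₂ (inj₁ (Together-map inj₁ (tree Λ) (occurs Λ v)))
                 ; (inj₂ v) → inj₂ (inj₂ (Together-map inj₂ (tree Ρ) (occurs Ρ v))) }
    ; edges = edges′
    } , refl
    where
    T U : BagTree (V l ⊎ V r)
    T = mapTree inj₁ (tree Λ)
    U = mapTree inj₂ (tree Ρ)
    hangsˡ : Hangs (slots l r) T
    hangsˡ p o with ∈-tabulate⁻ p | Occurs-map⁻ inj₁ (tree Λ) o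
    ... | z , e | v , refl , _ with splitAt (rk l) z
    hangsˡ p o | z , refl | v , refl , _ | inj₁ a = root-map inj₁ (tree Λ) (topˡ a)
    hangsʳ : Hangs (slots l r) U
    hangsʳ p o with ∈-tabulate⁻ p | Occurs-map⁻ inj₂ (tree Ρ) o
    ... | z , e | v , refl , _ with splitAt (rk l) z
    hangsʳ p o | z , refl | v , refl , _ | inj₂ b = root-map inj₂ (tree Ρ) (topʳ b)
    meet : ∀ {x} → Occurs T x → Occurs U x → x ∈ˡ slots l r
    meet o o′ with Occurs-map⁻ inj₁ (tree Λ) o | Occurs-map⁻ inj₂ (tree Ρ) o′
    ... | v , refl , _ | v′ , () , _
    edges′ : ∀ x y → joined l r x y ≡ true → Together (fork (slots l r) T U) x y
    edges′ (inj₁ v) (inj₁ w) e = inj₂ (inj₁ (Together-map inj₁ (tree Λ) (edges Λ v w e)))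
    edges′ (inj₂ v) (inj₂ w) e = inj₂ (inj₂ (Together-map inj₂ (tree Ρ) (edges Ρ v w e)))
    edges′ (inj₁ (inj₁ a)) (inj₂ (inj₁ b)) e = inj₁ (top∈slots l r (inj₁ a) , top∈slots l r (inj₂ b))
    edges′ (inj₂ (inj₁ b)) (inj₁ (inj₁ a)) e = inj₁ (top∈slots l r (inj₂ b) , top∈slots l r (inj₁ a))

  -- The invariant that all upper copies lie in the root bag lets the parent's fork bag hang above
  -- this tree without breaking connectivity.
  expansionLayout : ∀ B → RankBounded B →
    Σ (Layout (expansion B)) λ L → ∀ i → inj₁ i ∈ˡ root (tree L)
  expansionLayout (leaf x) 1≤k = record
    { tree = single (inj₁ zero ∷ [])
    ; valid = s≤s z≤n
    ; occurs = λ { (inj₁ zero) → here refl , here refl }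
    ; edges = λ x y ()
    } , λ { zero → here refl }
  expansionLayout B@(node l r) (q≤ , bˡ , bʳ) with expansionLayout l bˡ | expansionLayout r bʳ
  ... | Λ , topˡ | Ρ , topʳ = record
    { tree = tree R₂
    ; valid = R₂.valid
    ; occurs = λ { (inj₁ i) → root-together R₂.tree (R₂.new-root i) (R₂.new-root i)
                 ; (inj₂ (inj₁ i)) → R₂.keeps (root-together R₁.tree (R₁.new-root i) (R₁.new-root i))
                 ; (inj₂ (inj₂ w)) → R₂.keeps (R₁.keeps (Together-map inner (tree J) (occurs J w))) }
    ; edges = edges′
    } , R₂.new-root
    where
    open Replacement using (tree)
    open Basis (nodeBasis l r)
    joinedJ = joinedLayout l r bˡ bʳ Λ topˡ Ρ topʳ
    J : Layout (joined l r)
    J = proj₁ joinedJ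
    inner : V l ⊎ V r → V B
    inner w = inj₂ (inj₂ w)
    lower upper : Fin (rk B) → V B
    lower i = inj₂ (inj₁ i)
    upper = inj₁

    sel-injective : ∀ {i j} → sel i ≡ sel j → i ≡ j
    sel-injective {i} {j} e = ==⇒≡ (begin
      (i == j)        ≡⟨ sym (coord-sel i j) ⟩
      coord (sel i) j ≡⟨ cong (λ z → coord z j) e ⟩
      coord (sel j) j ≡⟨ coord-sel j j ⟩
      (j == j)        ≡⟨ ==-refl j ⟩
      true            ∎)
      where open ≡-Reasoning

    T₀ : BagTree (V B)
    T₀ = mapTree inner (Layout.tree J)
    -- At most 2k slots and one newcomer: here the bags may reach the full size 2k + 1.
    R₁ : Replacement (suc (2 * k)) T₀ (inner ∘ slot l r) sel lower
    R₁ = replace T₀ (inner ∘ slot l r) sel lower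
      (s≤s (+-mono-≤ (rank≤ l bˡ) (≤-trans (rank≤ r bʳ) (m≤m+n k 0))))
      (Valid-map inner (inj₂-injective ∘ inj₂-injective) (Layout.tree J) (valid J))
      (λ z → root-map inner (Layout.tree J) (subst (slot l r z ∈ˡ_) (sym (proj₂ joinedJ)) (∈-tabulate⁺ z)))
      sel-injective (λ e → inj₁-injective (inj₂-injective e)) fresh
      where
      fresh : ∀ i → ¬ Occurs T₀ (lower i)
      fresh i o with Occurs-map⁻ inner (Layout.tree J) o
      ... | w , () , _
    module R₁ = Replacement R₁
    -- From here on the slots are the lower copies alone, at most k of them. The children's basis
    -- vertices have met all their neighbours and are dropped.
    R₂ : Replacement (suc (2 * k)) R₁.tree lower id upper
    R₂ = replace R₁.tree lower id upper (s≤s (≤-trans q≤ (m≤m+n k (k + 0)))) R₁.valid R₁.new-root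
      id inj₁-injective fresh
      where
      fresh : ∀ i → ¬ Occurs R₁.tree (upper i)
      fresh i o with R₁.origin o
      ... | inj₂ (j , ())
      ... | inj₁ o′ with Occurs-map⁻ inner (Layout.tree J) o′
      ...   | w , () , _
    module R₂ = Replacement R₂

    -- A neighbour of lower copy `i` is never overwritten by another lower copy: if it is the slot
    -- selected by `j`, its coordinates are those of a unit vector, which forces `j ≡ i`.
    lower-inner : ∀ i w → onTops l r (λ z → coordinate l r z i) w ≡ true →
      Together R₂.tree (lower i) (inner w)
    lower-inner i w e with onTops-true l r _ w e
    ... | z , refl , e′ = R₂.keeps (subst (λ w → Together R₁.tree (lower i) (inner w)) (slot-join l r z)
            (R₁.meets i (join (rk l) (rk r) z) λ j sel-j →
               ==⇒≡ (trans (sym (coord-sel j i)) (trans (cong (λ z → coord z i) sel-j) e′))))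

    edges′ : ∀ x y → expansion B x y ≡ true → Together R₂.tree x y
    edges′ (inj₁ i)        (inj₂ (inj₁ j)) e with refl ← ==⇒≡ {x = i} {j} e = R₂.meets i i λ _ → id
    edges′ (inj₂ (inj₁ i)) (inj₁ j)        e with refl ← ==⇒≡ {x = i} {j} e =
      Together-sym R₂.tree (R₂.meets i i λ _ → id)
    edges′ (inj₂ (inj₁ i)) (inj₂ (inj₂ w)) e = lower-inner i w e
    edges′ (inj₂ (inj₂ w)) (inj₂ (inj₁ i)) e = Together-sym R₂.tree (lower-inner i w e)
    edges′ (inj₂ (inj₂ w)) (inj₂ (inj₂ u)) e =
      R₂.keeps (R₁.keeps (Together-map inner (Layout.tree J) (edges J w u e)))

  -- The root leaf stays a single vertex, represented by `tt`. Added to the at most 2k upper copies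
  -- of `l` and `r`, it gives one more bag of size at most 2k + 1, and the topmost node need not be
  -- split.
  rootedLayout : ∀ l r → RankBounded l → RankBounded r → (F : Fin n → ⊤ → Bool) →
    Layout (expanded₂ F (λ _ _ → false) l r)
  rootedLayout l r bˡ bʳ F = record
    { tree = extend b T
    ; valid = s≤s (subst (_≤ 2 * k) (sym (length-map inj₁ (slots l r))) (slots≤ l r bˡ bʳ))
            , hangs , Valid-map inj₁ inj₁-injective (tree J) (valid J)
    ; occurs = λ { (inj₁ w) → inj₂ (Together-map inj₁ (tree J) (occurs J w))
                 ; (inj₂ tt) → inj₁ (here refl , here refl) }
    ; edges = edges′
    }
    where
    Λ = expansionLayout l bˡ
    Ρ = expansionLayout r bʳ
    joinedJ = joinedLayout l r bˡ bʳ (proj₁ Λ) (proj₂ Λ) (proj₁ Ρ) (proj₂ Ρ)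
    J = proj₁ joinedJ
    T = mapTree inj₁ (tree J)
    b : List ((V l ⊎ V r) ⊎ ⊤)
    b = inj₂ tt ∷ map inj₁ (slots l r)
    hangs : Hangs b T
    hangs (here refl) o with Occurs-map⁻ inj₁ (tree J) o
    ... | w , () , _
    hangs (there p) o with ∈-map⁻ inj₁ p
    ... | w , q , refl = root-map inj₁ (tree J) (subst (w ∈ˡ_) (sym (proj₂ joinedJ)) q)
    top∈b : ∀ w → onTops l r (λ z → F (topLab l r z) tt) w ≡ true → inj₁ w ∈ˡ b
    top∈b w e with onTops-true l r (λ z → F (topLab l r z) tt) w e
    ... | z , refl , _ = there (∈-map⁺ inj₁ (top∈slots l r z))
    edges′ : ∀ x y → expanded₂ F (λ _ _ → false) l r x y ≡ true → Together (extend b T) x y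
    edges′ (inj₁ w)  (inj₁ u)  e = inj₂ (Together-map inj₁ (tree J) (edges J w u e))
    edges′ (inj₁ w)  (inj₂ tt) e = inj₁ (top∈b w e , here refl)
    edges′ (inj₂ tt) (inj₁ w)  e = inj₁ (here refl , top∈b w e)

-- From a rank-decomposition to a binary tree

countTrue-witness : ∀ {n} (f : Fin n → Bool) {m} → countTrue f ≡ suc m → ∃ λ u → f u ≡ true
countTrue-witness {suc n} f e with f zero in f₀
... | true  = zero , f₀
... | false = let u , p = countTrue-witness (f ∘ suc) e in suc u , p

countTrue-unique : ∀ {n} (f : Fin n → Bool) {u w} → countTrue f ≡ 1 → f u ≡ true → f w ≡ true → w ≡ u
countTrue-unique f {u} {w} e p q with w ≟ u
... | yes w≡u = w≡u
... | no w≢u with () ← trans (sym (suc-injective (trans (sym (countTrue-without f u p)) e)))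
                             (countTrue-without (f without u) w (true-without f q w≢u))

countTrue-three : ∀ {n} (f : Fin n → Bool) {u} → countTrue f ≡ 3 → f u ≡ true →
  ∃ λ a → ∃ λ b → (f a ≡ true × a ≢ u) × (f b ≡ true × b ≢ u) × b ≢ a ×
    (∀ w → f w ≡ true → w ≢ u → w ≡ a ⊎ w ≡ b)
countTrue-three f {u} e p = a , b , fa , without-true f (proj₁ gb) , proj₂ gb , others
  where
  g = f without u
  count-g : countTrue g ≡ 2
  count-g = suc-injective (trans (sym (countTrue-without f u p)) e)
  a = proj₁ (countTrue-witness g count-g)
  ga : g a ≡ true
  ga = proj₂ (countTrue-witness g count-g)
  fa : f a ≡ true × a ≢ u
  fa = without-true f ga
  count-h : countTrue (g without a) ≡ 1
  count-h = suc-injective (trans (sym (countTrue-without g a ga)) count-g)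
  b = proj₁ (countTrue-witness (g without a) count-h)
  hb : (g without a) b ≡ true
  hb = proj₂ (countTrue-witness (g without a) count-h)
  gb : g b ≡ true × b ≢ a
  gb = without-true g hb
  others : ∀ w → f w ≡ true → w ≢ u → w ≡ a ⊎ w ≡ b
  others w fw w≢u with w ≟ a
  ... | yes w≡a = inj₁ w≡a
  ... | no w≢a  = inj₂ (countTrue-unique (g without a) count-h hb
                          (true-without g (true-without f fw w≢u) w≢a))

module _ {t : ℕ} {A : Relation t} where

  end-∈ : ∀ {P : Fin t → Set} {x y} → Walk A P x y → P y
  end-∈ (stop p)     = p
  end-∈ (step _ _ w) = end-∈ w

  everywhere : ∀ {P Q : Fin t → Set} {x y} → Walk A P x y → (∀ {z} → Walk A P x z → Q z) → Walk A Q x y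
  everywhere (stop p)     q = stop (q (stop p))
  everywhere (step p e w) q = step (q (stop p)) e (everywhere w (q ∘ step p e))

  -- A walk that misses one end of an edge cannot use the edge.
  avoid-removeEdge : ∀ {z u v} → z ≡ u ⊎ z ≡ v → ∀ {x y} → Walk A (_≢ z) x y → Reach (removeEdge A u v) x y
  avoid-removeEdge _ (stop _) = stop tt
  avoid-removeEdge z∈ (step x≢z e w) =
    step tt (true-removeEdge A e (not-uv z∈) (not-vu z∈)) (avoid-removeEdge z∈ w)
    where
    not-uv : ∀ {u v} → _ ≡ u ⊎ _ ≡ v → ¬ (_ ≡ u × _ ≡ v)
    not-uv (inj₁ refl) (p , _) = x≢z p
    not-uv (inj₂ refl) (_ , q) = start-∈ w q
    not-vu : ∀ {u v} → _ ≡ u ⊎ _ ≡ v → ¬ (_ ≡ v × _ ≡ u)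
    not-vu (inj₁ refl) (_ , q) = start-∈ w q
    not-vu (inj₂ refl) (p , _) = x≢z p

  -- The tail is examined before the head, so the visit found is the last one and the remaining walk
  -- avoids `v`.
  lastVisit : ∀ {P : Fin t → Set} v {x y} → Walk A P x y →
    y ≡ v ⊎ (∃ λ a → A v a ≡ true × P a × Walk A (_≢ v) a y) ⊎ Walk A (_≢ v) x y
  lastVisit v {x} (stop p) with x ≟ v
  ... | yes x≡v = inj₁ x≡v
  ... | no x≢v  = inj₂ (inj₂ (stop x≢v))
  lastVisit v {x} (step p e w) with lastVisit v w
  ... | inj₁ y≡v       = inj₁ y≡v
  ... | inj₂ (inj₁ r)  = inj₂ (inj₁ r)
  ... | inj₂ (inj₂ w′) with x ≟ v
  ...   | yes refl = inj₂ (inj₁ (_ , e , start-∈ w , w′))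
  ...   | no x≢v   = inj₂ (inj₂ (step x≢v e w′))

  departure : ∀ {P : Fin t → Set} {v y} → Walk A P v y →
    y ≡ v ⊎ ∃ λ a → A v a ≡ true × P a × Walk A (_≢ v) a y
  departure {v = v} w with lastVisit v w
  ... | inj₁ e         = inj₁ e
  ... | inj₂ (inj₁ r)  = inj₂ r
  ... | inj₂ (inj₂ w′) = ⊥-elim (start-∈ w′ refl)

CutRank-resp : ∀ {n k} {G : Graph n} {X Y : Fin n → Set} →
  (∀ {x} → X x → Y x) → (∀ {x} → Y x → X x) → CutRankAtMost G X k → CutRankAtMost G Y k
CutRank-resp X⊆Y Y⊆X c r f f∈ indep =
  c r f (λ i → Y⊆X (f∈ i)) (λ a e → indep a (λ z z∉ → e z (z∉ ∘ X⊆Y)))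

CutBounded : ∀ {n} → Graph n → ℕ → BinTree n → Set
CutBounded G k B@(leaf x)   = CutRankAtMost G (_∈ B) k
CutBounded G k B@(node l r) = CutRankAtMost G (_∈ B) k × CutBounded G k l × CutBounded G k r

record Rooting {n : ℕ} (G : Graph n) (k : ℕ) : Set where
  field
    base     : Fin n
    l r      : BinTree n
    covers   : ∀ {x} → x ≢ base → x ∈ node l r
    base∉    : ¬ base ∈ node l r
    disjoint : Disjoint (node l r)
    bounded  : CutBounded G k (node l r)

module _ {n k : ℕ} {G : Graph n} (ρ : RankDecomposition G k) where
  open RankDecomposition ρ

  private
    A = adj T

  -- For an edge `uv` this is the component of `v` after deleting the edge. Avoiding the vertex `u`
  -- is easier to handle when the walk is cut at `v`.
  Branch : Fin t → Fin t → Fin t → Set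
  Branch u v = Walk A (_≢ u) v

  adj⇒≢ : ∀ {u v} → A u v ≡ true → u ≢ v
  adj⇒≢ {u} e refl = true≢false e (adj-irrefl T u)

  adj-flip : ∀ {u v} → A u v ≡ true → A v u ≡ true
  adj-flip e = trans (adj-sym T _ _) e

  -- Such a walk would close up through `v` to a cycle containing the edge `va`.
  branches-apart : ∀ {v a b} → A v a ≡ true → A v b ≡ true → b ≢ a → ¬ Branch v a b
  branches-apart {v} {a} {b} va vb b≢a w = proj₂ (proj₂ tree) v a va
    (step tt (true-removeEdge A vb (λ (_ , e) → b≢a e) (λ (e , _) → adj⇒≢ va e))
      (avoid-removeEdge (inj₁ refl) (reverseWalk (adj-sym T) w)))

  -- A walk from `a` that avoids `v` also avoids `u`, as `u` is a different neighbour of `v`.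
  sub-branch : ∀ {u v a y} → A u v ≡ true → A v a ≡ true → a ≢ u → Branch v a y → Branch u v y
  sub-branch {u} {v} {a} uv va a≢u w = step (adj⇒≢ (adj-flip uv)) va
    (everywhere w λ w′ → λ { refl → branches-apart va (adj-flip uv) (a≢u ∘ sym) w′ })

  branch⇒reach : ∀ {u v y} → Branch u v y → Reach (removeEdge A v u) v y
  branch⇒reach = avoid-removeEdge (inj₂ refl)

  reach⇒branch : ∀ {u v y} → A u v ≡ true → Reach (removeEdge A v u) v y → Branch u v y
  reach⇒branch {u} {v} uv w = mapWalk id (λ e → proj₁ (removeEdge-true A e)) id
    (everywhere w λ w′ → λ { refl → proj₂ (proj₂ tree) v u (adj-flip uv) w′ })

  branch-cutRank : ∀ {u v B} → A u v ≡ true →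
    (∀ {x} → x ∈ B → Branch u v (L x)) → (∀ {x} → Branch u v (L x) → x ∈ B) → CutRankAtMost G (_∈ B) k
  branch-cutRank {u} {v} uv into onto =
    CutRank-resp {G = G} (onto ∘ reach⇒branch uv) (branch⇒reach ∘ into) (width v u (adj-flip uv))

  record BranchTree (u v : Fin t) : Set where
    field
      shape    : BinTree n
      into     : ∀ {x} → x ∈ shape → Branch u v (L x)
      onto     : ∀ {x} → Branch u v (L x) → x ∈ shape
      disjoint : Disjoint shape
      bounded  : CutBounded G k shape

  -- R lists candidates for the vertices of the branch; it loses v at every step.
  branchTree : ∀ fuel (R : List (Fin t)) → length R ≤ fuel → ∀ u v → A u v ≡ true →
    (∀ {y} → Branch u v y → y ∈ˡ R) →
    BranchTree u v
  branchTree zero [] R≤ u v uv R⊇ with () ← R⊇ (stop (adj⇒≢ (adj-flip uv)))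
  branchTree (suc fuel) R R≤ u v uv R⊇ with subcubic v
  ... | inj₁ deg₁ with L-onto v deg₁
  ...   | x , refl = record
    { shape = leaf x ; into = into ; onto = onto ; disjoint = tt
    ; bounded = branch-cutRank {B = leaf x} uv into onto }
    where
    into : ∀ {y} → y ∈ leaf x → Branch u v (L y)
    into here = stop (adj⇒≢ (adj-flip uv))
    onto : ∀ {y} → Branch u v (L y) → y ∈ leaf x
    onto w with departure w
    ... | inj₁ e with refl ← L-inj e = here
    ... | inj₂ (a , va , a≢u , _) = ⊥-elim (a≢u (countTrue-unique (A v) deg₁ (adj-flip uv) va))
  branchTree (suc fuel) R R≤ u v uv R⊇ | inj₂ deg₃
    with countTrue-three (A v) deg₃ (adj-flip uv)
  ... | a , b , (va , a≢u) , (vb , b≢u) , b≢a , others =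
    combine (branchTree fuel R′ R′≤ v a va (R′⊇ va a≢u)) (branchTree fuel R′ R′≤ v b vb (R′⊇ vb b≢u))
    where
    ≢v? : ∀ y → Dec (y ≢ v)
    ≢v? y = ¬? (y ≟ v)
    R′ : List (Fin t)
    R′ = filter ≢v? R
    R′≤ : length R′ ≤ fuel
    R′≤ = ≤-pred (≤-trans (filter-notAll ≢v? R (lose (R⊇ (stop (adj⇒≢ (adj-flip uv)))) λ ≢ → ≢ refl)) R≤)
    R′⊇ : ∀ {c} → A v c ≡ true → c ≢ u → ∀ {y} → Branch v c y → y ∈ˡ R′
    R′⊇ vc c≢u w = ∈-filter⁺ ≢v? (R⊇ (sub-branch uv vc c≢u w)) (end-∈ w)
    combine : BranchTree v a → BranchTree v b → BranchTree u v
    combine α β = record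
      { shape = node l r ; into = into ; onto = onto ; disjoint = apart , α.disjoint , β.disjoint
      ; bounded = branch-cutRank {B = node l r} uv into onto , α.bounded , β.bounded }
      where
      module α = BranchTree α
      module β = BranchTree β
      l r : BinTree n
      l = α.shape
      r = β.shape
      into : ∀ {x} → x ∈ node l r → Branch u v (L x)
      into (left p)  = sub-branch uv va a≢u (α.into p)
      into (right p) = sub-branch uv vb b≢u (β.into p)
      onto : ∀ {x} → Branch u v (L x) → x ∈ node l r
      onto {x} w with departure w
      ... | inj₁ e with () ← trans (sym deg₃) (trans (cong (degree T) (sym e)) (L-leaf x))
      ... | inj₂ (c , vc , c≢u , w′) with others c vc c≢u
      ...   | inj₁ refl = left (α.onto w′)
      ...   | inj₂ refl = right (β.onto w′)
      apart : ∀ {x} → x ∈ l → ¬ x ∈ r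
      apart p q = branches-apart va vb b≢a (α.into p ⁀ reverseWalk (adj-sym T) (β.into q))

rooting : ∀ {n k} {G : Graph n} → 3 ≤ n → RankDecomposition G k → Rooting G k
rooting {suc (suc (suc n))} {k} {G} (s≤s (s≤s (s≤s z≤n))) ρ
  with countTrue-witness (adj (RankDecomposition.T ρ) (RankDecomposition.L ρ zero))
                         (RankDecomposition.L-leaf ρ zero)
... | v , uv = root-at (branchTree ρ _ (allFin t) ≤-refl u v uv (λ {y} _ → ∈-allFin y))
  where
  open RankDecomposition ρ
  u = L zero
  root-at : BranchTree ρ u v → Rooting G k
  root-at β = split B covers base∉ disjoint bounded
    where
    open BranchTree β renaming (shape to B)
    covers : ∀ {x} → x ≢ zero → x ∈ B
    covers {x} x≢0 with departure (proj₁ (proj₂ tree) u (L x))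
    ... | inj₁ e = ⊥-elim (x≢0 (L-inj e))
    ... | inj₂ (a , ua , _ , w) with refl ← countTrue-unique (adj T u) (L-leaf zero) uv ua = onto w
    base∉ : ¬ zero ∈ B
    base∉ p = end-∈ (into p) refl
    split : ∀ B → (∀ {x} → x ≢ zero → x ∈ B) → ¬ zero ∈ B → Disjoint B → CutBounded G k B → Rooting G k
    -- This is where three vertices are needed: two of them differ from the base, so the tree below
    -- it is not a single leaf.
    split (leaf y) covers _ _ _ with covers {suc zero} (λ ()) | covers {suc (suc zero)} (λ ())
    ... | here | ()
    split (node l r) covers base∉ disjoint bounded = record
      { base = zero ; l = l ; r = r ; covers = covers ; base∉ = base∉
      ; disjoint = disjoint ; bounded = bounded }

-- Counting vertices and conclusion

leaves : ∀ {n} → BinTree n → ℕ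
leaves (leaf x)   = 1
leaves (node l r) = leaves l + leaves r

leafAt : ∀ {n} (B : BinTree n) → Fin (leaves B) → Leaf B
leafAt (leaf x)   _ = tt
leafAt (node l r) i = Sum.map (leafAt l) (leafAt r) (splitAt (leaves l) i)

leafAt-injective : ∀ {n} (B : BinTree n) {i j} → leafAt B i ≡ leafAt B j → i ≡ j
leafAt-injective (leaf x) {zero} {zero} _ = refl
leafAt-injective (node l r) {i} {j} e
  = trans (sym (join-splitAt (leaves l) (leaves r) i))
      (trans (cong (join (leaves l) (leaves r))
                (split-injective (splitAt (leaves l) i) (splitAt (leaves l) j) e))
             (join-splitAt (leaves l) (leaves r) j))
  where
  split-injective : ∀ (p q : Fin (leaves l) ⊎ Fin (leaves r)) →
    Sum.map (leafAt l) (leafAt r) p ≡ Sum.map (leafAt l) (leafAt r) q → p ≡ q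
  split-injective (inj₁ p) (inj₁ q) e = cong inj₁ (leafAt-injective l (inj₁-injective e))
  split-injective (inj₂ p) (inj₂ q) e = cong inj₂ (leafAt-injective r (inj₂-injective e))

leafOf : ∀ {n} {B : BinTree n} {x} → x ∈ B → Leaf B
leafOf here      = tt
leafOf (left p)  = inj₁ (leafOf p)
leafOf (right p) = inj₂ (leafOf p)

label-leafOf : ∀ {n} {B : BinTree n} {x} (p : x ∈ B) → label B (leafOf p) ≡ x
label-leafOf here      = refl
label-leafOf (left p)  = label-leafOf p
label-leafOf (right p) = label-leafOf p

label-injective : ∀ {n} (B : BinTree n) → Disjoint B → ∀ {i j} → label B i ≡ label B j → i ≡ j
label-injective (leaf x)   _ _ = refl
label-injective (node l r) (_ , dl , _) {inj₁ i} {inj₁ j} e = cong inj₁ (label-injective l dl e)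
label-injective (node l r) (_ , _ , dr) {inj₂ i} {inj₂ j} e = cong inj₂ (label-injective r dr e)
label-injective (node l r) (apart , _) {inj₁ i} {inj₂ j} e =
  ⊥-elim (apart (label-∈ l i) (subst (_∈ r) (sym e) (label-∈ r j)))
label-injective (node l r) (apart , _) {inj₂ i} {inj₁ j} e =
  ⊥-elim (apart (label-∈ l j) (subst (_∈ r) e (label-∈ r i)))

leaf-cutRank : ∀ {n k} {G : Graph n} {B x} → CutBounded G k B → x ∈ B → CutRankAtMost G (_∈ leaf x) k
leaf-cutRank c here                = c
leaf-cutRank (_ , cl , _) (left p)  = leaf-cutRank cl p
leaf-cutRank (_ , _ , cr) (right p) = leaf-cutRank cr p

module Construction {n k : ℕ} {G : Graph n} (ρ : Rooting G k) where
  open Rooting ρ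
  open Expansion G
  open Layouts G k

  -- The row of `x` alone is nonzero at `y`, an independent family of size 1 in the cut of the leaf
  -- `x`.
  no-edge : k ≡ 0 → ∀ {x y} → x ∈ node l r → adj G x y ≢ true
  no-edge refl {x} {y} p e = 1+n≰n (leaf-cutRank {G = G} bounded p 1 (λ _ → x) (λ _ → here) independent)
    where
    zero-coefficient : ∀ b → (b ∧ adj G x y) xor false ≡ false → b ≡ false
    zero-coefficient b h rewrite e with b
    ... | false = refl
    independent : ∀ (a : Fin 1 → Bool) →
      (∀ c → ¬ c ∈ leaf x → (a zero ∧ adj G x c) xor false ≡ false) → ∀ i → a i ≡ false
    independent a h zero = zero-coefficient (a zero) (h y λ { here → true≢false e (adj-irrefl G x) })

  edgeless : k ≡ 0 → ∀ x y → adj G x y ≡ false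
  edgeless k≡0 x y with adj G x y in e
  ... | false = refl
  ... | true with x ≟ base | y ≟ base
  ...   | no x≢    | _        = ⊥-elim (no-edge k≡0 (covers x≢) e)
  ...   | yes _    | no y≢    = ⊥-elim (no-edge k≡0 (covers y≢) (trans (adj-sym G y x) e))
  ...   | yes refl | yes refl = ⊥-elim (true≢false e (adj-irrefl G x))

  -- The basis labels are themselves a family of rows of `B` to which the cut-rank bound applies;
  -- the zeroed columns inside `B` add no condition. A leaf has `rk` equal to 1 by convention,
  -- whence `1 ≤ k`.
  rankBounded : 1 ≤ k → ∀ B → CutBounded G k B → RankBounded B
  rankBounded 1≤k (leaf x)   _ = 1≤k
  rankBounded 1≤k B@(node l r) (c , cl , cr) =
    c (rk B) (lab B) (lab-∈ B) independent′ , rankBounded 1≤k l cl , rankBounded 1≤k r cr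
    where
    open Basis (nodeBasis l r)
    independent′ : ∀ (a : Fin (rk B) → Bool) →
      (∀ c → ¬ c ∈ B → xorSum (λ i → a i ∧ adj G (lab B i) c) ≡ false) → ∀ i → a i ≡ false
    independent′ a h = independent a λ c → vanishes c (c ∈? B)
      where
      vanishes : ∀ c → Dec (c ∈ B) → xorSum (λ i → a i ∧ cutRows l r (sel i) c) ≡ false
      vanishes c (no c∉)  = trans (xorSum-cong {rk B} λ i → cong (a i ∧_) (cutRows-outside l r (sel i) c∉)) (h c c∉)
      vanishes c (yes c∈) = xorSum-false {rk B} λ i → trans (cong (a i ∧_) (cutRows-inside l r (sel i) c∈)) (∧-zeroʳ (a i))

  rows : Fin n → ⊤ → Bool
  rows u tt = adj G u base

  vertices : Realisation G (original rows (λ _ _ → false) (node l r)) n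
  vertices = record
    { graph = G
    ; minor = ≼-refl {G = G}
    ; vertex = v
    ; index = w
    ; vertex∘index = vw
    ; index∘vertex = wv
    ; adj-vertex = λ i j → trans (cong₂ (adj G) (sym (wv i)) (sym (wv j))) (adj-index (v i) (v j))
    }
    where
    w : Leaf (node l r) ⊎ ⊤ → Fin n
    w (inj₁ i)  = label (node l r) i
    w (inj₂ tt) = base
    v : Fin n → Leaf (node l r) ⊎ ⊤
    v x with x ≟ base
    ... | yes _ = inj₂ tt
    ... | no x≢ = inj₁ (leafOf (covers x≢))
    wv : ∀ x → w (v x) ≡ x
    wv x with x ≟ base
    ... | yes e = sym e
    ... | no x≢ = label-leafOf (covers x≢)
    w-injective : ∀ {p q} → w p ≡ w q → p ≡ q
    w-injective {inj₁ p}  {inj₁ q}  e = cong inj₁ (label-injective (node l r) disjoint e)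
    w-injective {inj₁ p}  {inj₂ tt} e = ⊥-elim (base∉ (subst (_∈ node l r) e (label-∈ _ p)))
    w-injective {inj₂ tt} {inj₁ q}  e = ⊥-elim (base∉ (subst (_∈ node l r) (sym e) (label-∈ _ q)))
    w-injective {inj₂ tt} {inj₂ tt} e = refl
    vw : ∀ p → v (w p) ≡ p
    vw p = w-injective (wv (w p))
    adj-index : ∀ p q → adj G (w p) (w q) ≡ original rows (λ _ _ → false) (node l r) p q
    adj-index (inj₁ p)  (inj₁ q)  = refl
    adj-index (inj₁ p)  (inj₂ tt) = refl
    adj-index (inj₂ tt) (inj₁ q)  = adj-sym G _ _
    adj-index (inj₂ tt) (inj₂ tt) = adj-irrefl G base

  order : ℕ
  order = expandedOrder r (expandedOrder l n)

  realisation : Realisation G (expanded₂ rows (λ _ _ → false) l r) order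
  realisation = realise₂ rows (λ _ _ → false) l r
    (λ { tt → inj₁ (base , base∉ , λ _ → refl) }) disjoint vertices

  -- A binary tree with p leaves has p - 1 inner nodes, each adding at most 2k vertices. Moving the
  -- subtracted 2k to the left avoids truncated subtraction.
  expandedOrder≤ : ∀ B m → RankBounded B → expandedOrder B m + 2 * k ≤ m + 2 * k * leaves B
  expandedOrder≤ (leaf x) m _ = +-monoʳ-≤ m (≤-reflexive (lemma k))
    where
    lemma : ∀ k → 2 * k ≡ 2 * k * 1
    lemma = solve-∀
  expandedOrder≤ B@(node l r) m (q≤ , bl , br) = begin
    rk B * 2 + expandedOrder r m′ + 2 * k
      ≤⟨ +-monoˡ-≤ (2 * k) (+-monoˡ-≤ (expandedOrder r m′) (*-monoˡ-≤ 2 q≤)) ⟩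
    k * 2 + expandedOrder r m′ + 2 * k           ≡⟨ lemma₁ k (expandedOrder r m′) ⟩
    2 * k + (expandedOrder r m′ + 2 * k)         ≤⟨ +-monoʳ-≤ (2 * k) (expandedOrder≤ r m′ br) ⟩
    2 * k + (m′ + 2 * k * leaves r)              ≡⟨ lemma₂ k m′ (leaves r) ⟩
    (m′ + 2 * k) + 2 * k * leaves r              ≤⟨ +-monoˡ-≤ (2 * k * leaves r) (expandedOrder≤ l m bl) ⟩
    (m + 2 * k * leaves l) + 2 * k * leaves r    ≡⟨ lemma₃ k m (leaves l) (leaves r) ⟩
    m + 2 * k * (leaves l + leaves r)            ∎
    where
    open ≤-Reasoning
    m′ = expandedOrder l m
    lemma₁ : ∀ k x → k * 2 + x + 2 * k ≡ 2 * k + (x + 2 * k)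
    lemma₁ = solve-∀
    lemma₂ : ∀ k x p → 2 * k + (x + 2 * k * p) ≡ (x + 2 * k) + 2 * k * p
    lemma₂ = solve-∀
    lemma₃ : ∀ k m p q → (m + 2 * k * p) + 2 * k * q ≡ m + 2 * k * (p + q)
    lemma₃ = solve-∀

  leaves< : suc (leaves (node l r)) ≤ n
  leaves< = injective⇒≤ {f = f} f-injective
    where
    f : Fin (suc (leaves (node l r))) → Fin n
    f zero    = base
    f (suc i) = label (node l r) (leafAt (node l r) i)
    f-injective : ∀ {i j} → f i ≡ f j → i ≡ j
    f-injective {zero}  {zero}  e = refl
    f-injective {zero}  {suc j} e = ⊥-elim (base∉ (subst (_∈ node l r) (sym e) (label-∈ _ (leafAt (node l r) j))))
    f-injective {suc i} {zero}  e = ⊥-elim (base∉ (subst (_∈ node l r) e (label-∈ _ (leafAt (node l r) i))))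
    f-injective {suc i} {suc j} e = cong suc (leafAt-injective (node l r) (label-injective (node l r) disjoint e))

  -- Each of `l` and `r` saves 2k against its number of leaves, and the leaf at the base accounts
  -- for the third 2k in 6k.
  order≤ : RankBounded l → RankBounded r → order + 6 * k ≤ (2 * k + 1) * n
  order≤ bl br = begin
    order + 6 * k                                   ≡⟨ lemma₁ k order ⟩
    order + 2 * k + 4 * k                           ≤⟨ +-monoˡ-≤ (4 * k) (expandedOrder≤ r m br) ⟩
    m + 2 * k * leaves r + 4 * k                    ≡⟨ lemma₂ k m (leaves r) ⟩
    (m + 2 * k) + (2 * k * leaves r + 2 * k)        ≤⟨ +-monoˡ-≤ _ (expandedOrder≤ l n bl) ⟩
    (n + 2 * k * leaves l) + (2 * k * leaves r + 2 * k) ≡⟨ lemma₃ k n (leaves l) (leaves r) ⟩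
    n + 2 * k * suc (leaves l + leaves r)           ≤⟨ +-monoʳ-≤ n (*-monoʳ-≤ (2 * k) leaves<) ⟩
    n + 2 * k * n                                   ≡⟨ lemma₄ k n ⟩
    (2 * k + 1) * n                                 ∎
    where
    open ≤-Reasoning
    m = expandedOrder l n
    lemma₁ : ∀ k x → x + 6 * k ≡ x + 2 * k + 4 * k
    lemma₁ = solve-∀
    lemma₂ : ∀ k m p → m + 2 * k * p + 4 * k ≡ (m + 2 * k) + (2 * k * p + 2 * k)
    lemma₂ = solve-∀
    lemma₃ : ∀ k n p q → (n + 2 * k * p) + (2 * k * q + 2 * k) ≡ n + 2 * k * suc (p + q)
    lemma₃ = solve-∀
    lemma₄ : ∀ k n → n + 2 * k * n ≡ (2 * k + 1) * n
    lemma₄ = solve-∀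

  layoutDecomposition : ∀ {X : Set} {A : X → X → Bool} {m} (R : Realisation G A m) → Layout A →
    TreeDecomposition (graph R) (2 * k)
  layoutDecomposition R Λ = treeDecomposition (graph R) (mapTree (index R) (Layout.tree Λ))
    (Valid-map (index R) index-injective (Layout.tree Λ) (Layout.valid Λ))
    (λ i → together i i (Layout.occurs Λ (vertex R i)))
    (λ i j e → together i j (Layout.edges Λ _ _ (trans (sym (adj-vertex R i j)) e)))
    where
    index-injective : ∀ {x y} → index R x ≡ index R y → x ≡ y
    index-injective {x} {y} e =
      trans (sym (vertex∘index R x)) (trans (cong (vertex R) e) (vertex∘index R y))
    together : ∀ i j → Together (Layout.tree Λ) (vertex R i) (vertex R j) →
      Together (mapTree (index R) (Layout.tree Λ)) i j
    together i j p = subst₂ (Together (mapTree (index R) (Layout.tree Λ)))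
      (index∘vertex R i) (index∘vertex R j) (Together-map (index R) (Layout.tree Λ) p)

singletons : ∀ n → BagTree (Fin n)
singletons zero    = single []
singletons (suc n) = extend (zero ∷ []) (mapTree suc (singletons n))

singletons-valid : ∀ n → Valid 1 (singletons n)
singletons-valid zero    = z≤n
singletons-valid (suc n) = s≤s z≤n , hangs , Valid-map suc (λ { refl → refl }) (singletons n) (singletons-valid n)
  where
  hangs : Hangs (zero ∷ []) (mapTree suc (singletons n))
  hangs (here refl) o with Occurs-map⁻ suc (singletons n) o
  ... | _ , () , _

singletons-occurs : ∀ n x → Occurs (singletons n) x
singletons-occurs (suc n) zero    = inj₁ (here refl , here refl)
singletons-occurs (suc n) (suc x) = inj₂ (Together-map suc (singletons n) (singletons-occurs n x))

edgelessDecomposition : ∀ {n} (G : Graph n) → (∀ x y → adj G x y ≡ false) → TreeDecomposition G 0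
edgelessDecomposition {n} G none = treeDecomposition G (singletons n) (singletons-valid n) (singletons-occurs n)
  λ x y e → ⊥-elim (true≢false e (none x y))

≈⇒≅ : ∀ {n} {G H : Graph n} → G ≈ H → G ≅ H
≈⇒≅ {n} e = ⤖-id (Fin n) , e

theorem3p1 : (k n : ℕ) (G : Graph n) → 3 ≤ n → RankWidthAtMost G k →
    Σ ℕ λ m → Σ (Graph m) λ H →
    (Σ ℕ λ p → Σ (Graph p) λ G′ → (G′ ≤pm H) × (G′ ≅ G)) ×
    TreeWidthAtMost H (2 * k) ×
    (m + 6 * k ≤ (2 * k + 1) * n)
theorem3p1 k n G 3≤n (inj₁ n≤1) with s≤s () ← ≤-trans 3≤n n≤1
-- For `k = 0` the graph has no edges and the bound on the order is `n`, so `G` itself serves as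
-- `H`, with bags of at most one vertex.
theorem3p1 zero n G 3≤n (inj₂ ρ) =
  n , G , (n , G , pm-refl , ≈⇒≅ {G = G} {G} λ _ _ → refl) ,
  edgelessDecomposition G (Construction.edgeless (rooting 3≤n ρ) refl) , ≤-refl
theorem3p1 k@(suc _) n G 3≤n (inj₂ ρ) =
  order , graph realisation ,
  (n , proj₁ (minor realisation) , proj₁ (proj₂ (minor realisation)) ,
    ≈⇒≅ {G = proj₁ (minor realisation)} {G} (proj₂ (proj₂ (minor realisation)))) ,
  layoutDecomposition realisation (rootedLayout l r bl br rows) , order≤ bl br
  where
  open Rooting (rooting 3≤n ρ)
  open Construction (rooting 3≤n ρ)
  open Layouts G k
  bl : RankBounded l
  bl = rankBounded (s≤s z≤n) l (proj₁ (proj₂ bounded))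
  br : RankBounded r
  br = rankBounded (s≤s z≤n) r (proj₂ (proj₂ bounded))
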